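{- Let $p,t$ be positive integers and let $n_1,\dots,n_p$ and $k_1,\dots,k_p$ be positive integers with $k_i\le n_i$ for all $i\in[p]$. Let $X=[n]$ with $n=n_1+\cdots+n_p$, partitioned into consecutive blocks $X_1=[n_1]$ and $X_i=\left[\sum_{j\le i}n_j\right]\setminus\left[\sum_{j\le i-1}n_j\right]$ for $i=2,\dots,p$, and put $k=k_1+\cdots+k_p$ and $$\mathcal{H}_1=\left\{F\in\binom{X}{k}:|F\cap X_i|=k_i,\ i=1,\dots,p\right\}.$$ Suppose $\mathcal{F}\subset\mathcal{H}_1$ is $t$-intersecting, i.e. $|A\cap B|\ge t$ for all $A,B\in\mathcal{F}$. If $n_i>2(t+1)pk_i^2$ for every $i\in[p]$, then $$|\mathcal{F}|\le\max_{\substack{t_1+\cdots+t_p=t\\ t_1,\dots,t_p\in\mathbb{N}}}\prod_{i\in[p]}\binom{n_i-t_i}{k_i-t_i}.$$ Moreover, equality holds if and only if $\mathcal{F}=\{F\in\mathcal{H}_1: T\subset F\}$ for some $T\in\binom{X}{t}$ such that $$\frac{k_i-|T\cap X_i|}{n_i-|T\cap X_i|}\le\frac{k_j-|T\cap X_j|+1}{n_j-|T\cap X_j|+1}$$ for every $i\in[p]$ and every $j\in[p]$ with $|T\cap X_j|\ge1$.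
   Context: $\mathbb{N}$ denotes the non-negative integers; $\binom{a}{b}=0$ when $b<0$ or $b>a$. $\binom{X}{m}$ denotes the family of all $m$-element subsets of $X$, and $[m]=\{1,\dots,m\}$. -}

module Defs where

open import Data.Nat using (ℕ; zero; suc; _+_; _*_; _∸_; _≤_; _<_; _≤?_; _<?_)
open import Data.Nat.Combinatorics using (_C_)
open import Data.Fin using (Fin; toℕ)
import Data.Fin as Fin
open import Data.Fin.Subset using (Subset; _∩_; ∣_∣; _⊆_)
open import Data.Vec using (tabulate)
open import Data.Bool using (Bool)
open import Data.Product using (_×_; Σ)
open import Data.List using (List)
open import Data.List.Membership.Propositional using (_∈_)
open import Relation.Nullary.Decidable using (⌊_⌋; _×-dec_; yes; no)
open import Relation.Binary.PropositionalEquality using (_≡_)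
import Data.Integer as ℤ

total : ∀ {p} → (Fin p → ℕ) → ℕ
total {zero}  f = 0
total {suc p} f = f Fin.zero + total (λ i → f (Fin.suc i))

prod : ∀ {p} → (Fin p → ℕ) → ℕ
prod {zero}  f = 1
prod {suc p} f = f Fin.zero * prod (λ i → f (Fin.suc i))

sumBefore : ∀ {p} → (Fin p → ℕ) → Fin p → ℕ
sumBefore f Fin.zero    = 0
sumBefore f (Fin.suc i) = f Fin.zero + sumBefore (λ j → f (Fin.suc j)) i

-- the ground set X = [n] is modelled as Fin (total ns) (elements 0..n-1);
-- block X_i = elements x with sumBefore ns i ≤ x < sumBefore ns i + ns i
block : ∀ {p} (ns : Fin p → ℕ) → Fin p → Subset (total ns)
block ns i = tabulate λ x →
  ⌊ (sumBefore ns i ≤? toℕ x) ×-dec (toℕ x <? sumBefore ns i + ns i) ⌋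

blockCount : ∀ {p} (ns : Fin p → ℕ) → Subset (total ns) → Fin p → ℕ
blockCount ns A i = ∣ A ∩ block ns i ∣

InH1 : ∀ {p} (ns ks : Fin p → ℕ) → Subset (total ns) → Set
InH1 ns ks A = (∣ A ∣ ≡ total ks) × (∀ i → blockCount ns A i ≡ ks i)

-- binomial coefficient binom(a - c, b - c) with the convention that it is 0 when b - c < 0
binomSub : ℕ → ℕ → ℕ → ℕ
binomSub a b c with c ≤? b
... | yes _ = (a ∸ c) C (b ∸ c)
... | no  _ = 0

prodBinom : ∀ {p} (ns ks ts : Fin p → ℕ) → ℕ
prodBinom ns ks ts = prod (λ i → binomSub (ns i) (ks i) (ts i))

IsMaxProd : ∀ {p} (ns ks : Fin p → ℕ) (t m : ℕ) → Set
IsMaxProd ns ks t m =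
  Σ _ (λ ts → total ts ≡ t × prodBinom ns ks ts ≡ m)
  × (∀ ts → total ts ≡ t → prodBinom ns ks ts ≤ m)

TIntersecting : ∀ {N} → ℕ → List (Subset N) → Set
TIntersecting t 𝓕 = ∀ {A B} → A ∈ 𝓕 → B ∈ 𝓕 → t ≤ ∣ A ∩ B ∣

-- the ratio condition (k_i - a_i)/(n_i - a_i) ≤ (k_j - a_j + 1)/(n_j - a_j + 1),
-- a_i = |T ∩ X_i|, cross-multiplied over ℤ (both denominators are positive under
-- the hypotheses of the theorem, since a_i ≤ t < n_i)
RatioCond : ∀ {p} (ns ks : Fin p → ℕ) → Subset (total ns) → Fin p → Fin p → Set
RatioCond ns ks T i j =
  ((ℤ.+ ks i ℤ.- ℤ.+ ai) ℤ.* (ℤ.+ ns j ℤ.- ℤ.+ aj ℤ.+ ℤ.+ 1))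
    ℤ.≤ ((ℤ.+ ks j ℤ.- ℤ.+ aj ℤ.+ ℤ.+ 1) ℤ.* (ℤ.+ ns i ℤ.- ℤ.+ ai))
  where
    ai = blockCount ns T i
    aj = blockCount ns T j

{-# OPTIONS --safe #-}
module Submission where

-- Let N(S) be the number of members of H₁ containing S and E = 2(t + 1). Call Y a cover if it meets
-- every member of 𝓕 in at least t points, and let Y be a smallest cover, |Y| = t + r. A set S with
-- |S| < t + r is no cover, so some B ∈ 𝓕 has |S ∩ B| < t and every member of 𝓕 containing S contains
-- some S ∪ {x} with x ∈ B ∖ S; since n_i > E p k_i², the sum of N(S ∪ {x}) over x ∈ B ∖ S is at most
-- N(S) / E. Branching r times from each t-subset of Y, of which there are C(t + r, t) ≤ (t + 1)^r,
-- gives |𝓕| ≤ m / 2^r. So |𝓕| < m unless r = 0, and then 𝓕 lies in the star of Y.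
-- The ratio condition is local optimality of the profile of T. Since the factors (k - a) / (n - a)
-- of the binomials decrease in a, local optimality is global optimality.

open import Defs
open import Data.Bool as Bool using (true; false)
open import Data.Empty using (⊥-elim)
open import Data.Fin as Fin using (Fin; zero; suc; toℕ; _↑ˡ_; _↑ʳ_)
open import Data.Fin.Properties using (toℕ-↑ˡ; toℕ-↑ʳ; toℕ<n; splitAt-↑ˡ; splitAt-↑ʳ; splitAt⁻¹-↑ˡ; splitAt⁻¹-↑ʳ; any?)
open import Data.Fin.Subset as Subset using (Subset; ∣_∣; _⊆_; _∩_; ⊥; ⊤)
open import Data.Fin.Subset.Properties using (∣p∣≤n; ∩-zeroʳ; ∩-identityʳ; ∣⊥∣≡0; s⊆s; out⊆; drop-∷-⊆; p⊆q⇒∣p∣≤∣q∣; p⊂q⇒∣p∣<∣q∣; _⊆?_; anySubset?; x∈p∩q⁺; x∈p∩q⁻; ∣p∩q∣≤∣q∣; p∩q⊆q; ∩-comm)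
  renaming (_∈?_ to _∈ˢ?_)
import Data.Integer as ℤ
import Data.Integer.Properties as ℤₚ
open import Data.Integer.Tactic.RingSolver using () renaming (solve-∀ to solve-∀-ℤ)
open import Data.List as List using (List; []; _∷_; map; length; filter; cartesianProductWith)
open import Data.List.Membership.Propositional using (_∈_; find)
open import Data.List.Membership.Propositional.Properties using (∈-map⁺; ∈-map⁻; ∈-++⁺ˡ; ∈-++⁺ʳ; ∈-++⁻; ∈-cartesianProductWith⁺; ∈-cartesianProductWith⁻; ∈-∃++; ∈-filter⁻)
import Data.List.Membership.DecPropositional as DecMembership
open import Data.List.Properties using (length-map; length-++; length-++-sucʳ; filter-none; filter-accept)
open import Data.List.Relation.Unary.All as All using (All; []; _∷_)
open import Data.List.Relation.Unary.All.Properties using (¬All⇒Any¬; ¬Any⇒All¬)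
open import Data.List.Relation.Unary.AllPairs using ([]; _∷_)
open import Data.List.Relation.Unary.Any using (here; there)
open import Data.List.Relation.Unary.Unique.Propositional using (Unique)
import Data.List.Relation.Unary.Unique.Propositional.Properties as Unique
open import Data.Nat
open import Data.Nat.Combinatorics using (_C_; nC1≡n; nCn≡1; k>n⇒nCk≡0; nCk+nC[k+1]≡[n+1]C[k+1])
open import Data.Nat.ListAction using (sum)
open import Data.Nat.Properties
open import Data.Nat.Tactic.RingSolver using (solve-∀)
open import Data.Product using (_×_; _,_; ∃; proj₁; proj₂)
open import Data.Sum using (_⊎_; inj₁; inj₂; [_,_]′)
open import Data.Unit using (tt)
open import Data.Vec as Vec using ([]; _∷_; _++_; tabulate; here; there; replicate; lookup; _[_]≔_)
open import Data.Vec.Functional using (updateAt)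
open import Data.Vec.Functional.Properties using (updateAt-updates; updateAt-minimal)
open import Data.Vec.Properties using (zipWith-++; tabulate-cong; lookup-++ˡ; lookup-++ʳ; []≔-++-↑ˡ; []≔-++-↑ʳ; ∷-injectiveʳ; ++-injective; []=⇒lookup; lookup⇒[]=; ≡-dec; lookup∘update′)
open import Function using (_∘_; id)
open import Function.Bundles using (_⇔_; mk⇔; Equivalence)
open import Relation.Binary.Definitions using (tri<; tri≈; tri>)
open import Relation.Binary.PropositionalEquality
open import Relation.Nullary using (¬_; yes; no; contradiction; Dec; ¬?)
open import Relation.Nullary.Decidable using (⌊_⌋; _×-dec_)
open import Relation.Unary using (Decidable)
open import Algebra.Properties.CommutativeSemigroup +-commutativeSemigroup using () renaming (interchange to +-interchange)
open import Algebra.Properties.CommutativeSemigroup *-commutativeSemigroup using () renaming (interchange to *-interchange; xy∙z≈xz∙y to xy∙z≡xz∙y)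
open ≤-Reasoning

-- The constant is spent as follows. A point of block i multiplies N by at most k_i / n_i, and B has
-- k_i points there, so the block contributes at most (k_i² / n_i) N(S) ≤ N(S) / (E p); the p blocks
-- together give N(S) / E. In E itself, the factor t + 1 pays for the choice of the starting t-sets,
-- and the factor 2 is what makes the bound strict for r > 0, so that only stars can reach m. The
-- degenerate case is t > k. Every product is then 0, so m = 0 and the empty family is extremal. It
-- determines no T, yet the equivalence asks for one satisfying the ratio condition. A balanced
-- profile is therefore built independently of 𝓕, and the ratio condition has to make sense for
-- profiles with negative k_i - |T ∩ X_i|.

-- Sums and products over the coordinates

total-cong : ∀ {p} {f g : Fin p → ℕ} → (∀ i → f i ≡ g i) → total f ≡ total g
total-cong {zero}  h = refl
total-cong {suc p} h = cong₂ _+_ (h zero) (total-cong (h ∘ suc))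

total-mono : ∀ {p} {f g : Fin p → ℕ} → (∀ i → f i ≤ g i) → total f ≤ total g
total-mono {zero}  h = z≤n
total-mono {suc p} h = +-mono-≤ (h zero) (total-mono (h ∘ suc))

total-+ : ∀ {p} (f g : Fin p → ℕ) → total (λ i → f i + g i) ≡ total f + total g
total-+ {zero}  f g = refl
total-+ {suc p} f g = trans (cong (f zero + g zero +_) (total-+ (f ∘ suc) (g ∘ suc))) (+-interchange (f zero) (g zero) (total (f ∘ suc)) (total (g ∘ suc)))

≤-total-at : ∀ {p} (f : Fin p → ℕ) i → f i ≤ total f
≤-total-at f zero    = m≤m+n _ _
≤-total-at f (suc i) = ≤-trans (≤-total-at (f ∘ suc) i) (m≤n+m _ _)

total-updateAt-suc : ∀ {p} (f : Fin p → ℕ) i → total (updateAt f i suc) ≡ suc (total f)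
total-updateAt-suc f zero    = refl
total-updateAt-suc f (suc i) = trans (cong (f zero +_) (total-updateAt-suc (f ∘ suc) i)) (+-suc _ _)

total>0⇒∃>0 : ∀ {p} (f : Fin p → ℕ) → 1 ≤ total f → ∃ λ i → 1 ≤ f i
total>0⇒∃>0 {suc p} f h with f zero in eq
... | suc _ = zero , subst (1 ≤_) (sym eq) (s≤s z≤n)
... | zero  = let i , q = total>0⇒∃>0 (f ∘ suc) h in suc i , q

prod-cong : ∀ {p} {f g : Fin p → ℕ} → (∀ i → f i ≡ g i) → prod f ≡ prod g
prod-cong {zero}  h = refl
prod-cong {suc p} h = cong₂ _*_ (h zero) (prod-cong (h ∘ suc))

prod-mono : ∀ {p} {f g : Fin p → ℕ} → (∀ i → f i ≤ g i) → prod f ≤ prod g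
prod-mono {zero}  h = ≤-refl
prod-mono {suc p} h = *-mono-≤ (h zero) (prod-mono (h ∘ suc))

prod-* : ∀ {p} (f g : Fin p → ℕ) → prod (λ i → f i * g i) ≡ prod f * prod g
prod-* {zero}  f g = refl
prod-* {suc p} f g = trans (cong (f zero * g zero *_) (prod-* (f ∘ suc) (g ∘ suc))) (*-interchange (f zero) (g zero) (prod (f ∘ suc)) (prod (g ∘ suc)))

prod-^ : ∀ {p} b (f : Fin p → ℕ) → prod (λ i → b ^ f i) ≡ b ^ total f
prod-^ {zero}  b f = refl
prod-^ {suc p} b f = trans (cong (b ^ f zero *_) (prod-^ b (f ∘ suc))) (sym (^-distribˡ-+-* b (f zero) (total (f ∘ suc))))

prod>0⇒>0 : ∀ {p} (f : Fin p → ℕ) → 1 ≤ prod f → ∀ i → 1 ≤ f i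
prod>0⇒>0 f h zero with f zero
... | suc _ = s≤s z≤n
prod>0⇒>0 f h (suc i) = prod>0⇒>0 (f ∘ suc) (tail>0 (f zero) h) i
  where
  tail>0 : ∀ a {b} → 1 ≤ a * b → 1 ≤ b
  tail>0 a {zero}  q = ⊥-elim (<-irrefl refl (subst (1 ≤_) (*-zeroʳ a) q))
  tail>0 a {suc b} q = s≤s z≤n

prod-scale-at : ∀ {p} (f g : Fin p → ℕ) i {x y} → (∀ j → j ≢ i → f j ≡ g j) →
                f i * x ≡ g i * y → prod f * x ≡ prod g * y
prod-scale-at f g zero {x} {y} same eq = begin-equality
  f zero * prod (f ∘ suc) * x  ≡⟨ xy∙z≡xz∙y (f zero) _ x ⟩
  f zero * x * prod (f ∘ suc)  ≡⟨ cong₂ _*_ eq (prod-cong λ j → same (suc j) λ ()) ⟩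
  g zero * y * prod (g ∘ suc)  ≡⟨ xy∙z≡xz∙y (g zero) _ y ⟨
  g zero * prod (g ∘ suc) * y  ∎
prod-scale-at f g (suc i) {x} {y} same eq = begin-equality
  f zero * prod (f ∘ suc) * x    ≡⟨ *-assoc (f zero) _ x ⟩
  f zero * (prod (f ∘ suc) * x)  ≡⟨ cong₂ _*_ (same zero λ ()) (prod-scale-at (f ∘ suc) (g ∘ suc) i
                                      (λ j j≢i → same (suc j) λ { refl → j≢i refl }) eq) ⟩
  g zero * (prod (g ∘ suc) * y)  ≡⟨ *-assoc (g zero) _ y ⟨
  g zero * prod (g ∘ suc) * y    ∎

-- Binomial coefficients and their consecutive quotients

-- Absorption identity. Pascal's rule splits the left side, the induction hypotheses at `k` and
-- `suc k` apply to the two parts, and Pascal's rule in row `n` joins them again.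
suc-*-C : ∀ n k → suc k * (suc n C suc k) ≡ suc n * (n C k)
suc-*-C n zero    = trans (+-identityʳ _) (trans (nC1≡n (suc n)) (sym (*-identityʳ (suc n))))
suc-*-C zero (suc k) = trans (cong (suc (suc k) *_) (k>n⇒nCk≡0 {1} {suc (suc k)} (s≤s (s≤s z≤n))))
                         (trans (*-zeroʳ k) (sym (cong (1 *_) (k>n⇒nCk≡0 {0} {suc k} (s≤s z≤n)))))
suc-*-C (suc n) (suc k) = begin-equality
  suc (suc k) * (suc (suc n) C suc (suc k))
    ≡⟨ cong (suc (suc k) *_) (nCk+nC[k+1]≡[n+1]C[k+1] (suc n) (suc k)) ⟨
  suc (suc k) * (b + c)                           ≡⟨ split k b c ⟩
  b + (suc k * b + suc (suc k) * c)               ≡⟨ cong (b +_) (cong₂ _+_ (suc-*-C n k) (suc-*-C n (suc k))) ⟩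
  b + (suc n * (n C k) + suc n * (n C suc k))     ≡⟨ cong (b +_) (*-distribˡ-+ (suc n) (n C k) (n C suc k)) ⟨
  b + suc n * (n C k + n C suc k)                 ≡⟨ cong (λ z → b + suc n * z) (nCk+nC[k+1]≡[n+1]C[k+1] n k) ⟩
  b + suc n * b                                   ≡⟨⟩
  suc (suc n) * b                                 ∎
  where
  b = suc n C suc k
  c = suc n C suc (suc k)
  split : ∀ k b c → suc (suc k) * (b + c) ≡ b + (suc k * b + suc (suc k) * c)
  split = solve-∀

-- In Pascal's rule one summand lowers `t` and the other lowers `r`; they contribute at most `t + 1`
-- and 1 copies of `(t + 2) ^ r`.
C≤^ : ∀ t r → (t + r) C t ≤ suc t ^ r
C≤^ zero    r       = ≤-reflexive (sym (^-zeroˡ r))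
C≤^ (suc t) zero    = ≤-reflexive (trans (cong (λ z → suc z C suc t) (+-identityʳ t)) (nCn≡1 (suc t)))
C≤^ (suc t) (suc r) = begin
  suc (t + suc r) C suc t                   ≡⟨ nCk+nC[k+1]≡[n+1]C[k+1] (t + suc r) t ⟨
  (t + suc r) C t + (t + suc r) C suc t     ≡⟨ cong (λ z → (t + suc r) C t + z C suc t) (+-suc t r) ⟩
  (t + suc r) C t + (suc t + r) C suc t     ≤⟨ +-mono-≤ (C≤^ t (suc r)) (C≤^ (suc t) r) ⟩
  suc t ^ suc r + suc (suc t) ^ r           ≤⟨ +-monoˡ-≤ _ (*-monoʳ-≤ (suc t) (^-monoˡ-≤ r (n≤1+n (suc t)))) ⟩
  suc t * suc (suc t) ^ r + suc (suc t) ^ r ≡⟨ +-comm (suc t * suc (suc t) ^ r) _ ⟩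
  suc (suc t) ^ suc r                       ∎

binomSub-≤ : ∀ n k {a} → a ≤ k → binomSub n k a ≡ (n ∸ a) C (k ∸ a)
binomSub-≤ n k {a} a≤k with a ≤? k
... | yes _ = refl
... | no ¬p = contradiction a≤k ¬p

binomSub-> : ∀ n k {a} → k < a → binomSub n k a ≡ 0
binomSub-> n k {a} k<a with a ≤? k
... | yes p = contradiction k<a (≤⇒≯ p)
... | no _  = refl

binomSub>0⇒≤ : ∀ n k a → 1 ≤ binomSub n k a → a ≤ k
binomSub>0⇒≤ n k a h with a ≤? k
... | yes p = p
binomSub>0⇒≤ n k a () | no _

binomSub-suc-suc-suc : ∀ n k a → binomSub (suc n) (suc k) (suc a) ≡ binomSub n k a
binomSub-suc-suc-suc n k a with a ≤? k
... | yes a≤k = binomSub-≤ (suc n) (suc k) (s≤s a≤k)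
... | no  a≰k = binomSub-> (suc n) (suc k) (s≤s (≰⇒> a≰k))

binomSub-pascal : ∀ {n a} k → a ≤ n → binomSub n k a + binomSub n (suc k) a ≡ binomSub (suc n) (suc k) a
binomSub-pascal {n} {a} k a≤n with <-cmp a (suc k)
... | tri< (s≤s a≤k) _ _ = begin-equality
  binomSub n k a + binomSub n (suc k) a
    ≡⟨ cong₂ _+_ (binomSub-≤ n k a≤k) (binomSub-≤ n (suc k) (m≤n⇒m≤1+n a≤k)) ⟩
  (n ∸ a) C (k ∸ a) + (n ∸ a) C (suc k ∸ a)      ≡⟨ cong (λ z → (n ∸ a) C (k ∸ a) + (n ∸ a) C z) (+-∸-assoc 1 a≤k) ⟩
  (n ∸ a) C (k ∸ a) + (n ∸ a) C suc (k ∸ a)      ≡⟨ nCk+nC[k+1]≡[n+1]C[k+1] (n ∸ a) (k ∸ a) ⟩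
  suc (n ∸ a) C suc (k ∸ a)                      ≡⟨ cong₂ _C_ (+-∸-assoc 1 a≤n) (+-∸-assoc 1 a≤k) ⟨
  (suc n ∸ a) C (suc k ∸ a)                      ≡⟨ binomSub-≤ (suc n) (suc k) (m≤n⇒m≤1+n a≤k) ⟨
  binomSub (suc n) (suc k) a                     ∎
-- At the boundary the first term is 0 by convention, whereas the truncated `k ∸ suc k` would turn
-- it into 1; the other two are binomials with lower index 0.
... | tri≈ _ refl _ = begin-equality
  binomSub n k (suc k) + binomSub n (suc k) (suc k)
    ≡⟨ cong₂ _+_ (binomSub-> n k ≤-refl) (diag n) ⟩
  1                                ≡⟨ diag (suc n) ⟨
  binomSub (suc n) (suc k) (suc k) ∎
  where
  diag : ∀ n → binomSub n (suc k) (suc k) ≡ 1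
  diag n = trans (binomSub-≤ n (suc k) ≤-refl) (cong ((n ∸ suc k) C_) (n∸n≡0 k))
... | tri> _ _ k<a = trans (cong₂ _+_ (binomSub-> n k (<-trans ≤-refl k<a)) (binomSub-> n (suc k) k<a))
                       (sym (binomSub-> (suc n) (suc k) k<a))

-- The absorption identity as a quotient: one more prescribed point multiplies the count by
-- `(k - a) / (n - a)`, the quantity that the ratio condition compares. In product form it also
-- covers `k ≤ a`, where both sides vanish.
binomSub-suc : ∀ n k {a} → a < n → binomSub n k (suc a) * (n ∸ a) ≡ binomSub n k a * (k ∸ a)
binomSub-suc n k {a} a<n with k ≤? a
... | yes k≤a = trans (cong (_* (n ∸ a)) (binomSub-> n k (s≤s k≤a)))
                  (sym (trans (cong (binomSub n k a *_) (m≤n⇒m∸n≡0 k≤a)) (*-zeroʳ (binomSub n k a))))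
... | no  k≰a = begin-equality
  binomSub n k (suc a) * (n ∸ a)
    ≡⟨ cong₂ _*_ (binomSub-≤ n k a<k) (pred-∸ a<n) ⟩
  ((n ∸ suc a) C (k ∸ suc a)) * suc (n ∸ suc a)        ≡⟨ *-comm _ (suc (n ∸ suc a)) ⟩
  suc (n ∸ suc a) * ((n ∸ suc a) C (k ∸ suc a))        ≡⟨ suc-*-C (n ∸ suc a) (k ∸ suc a) ⟨
  suc (k ∸ suc a) * (suc (n ∸ suc a) C suc (k ∸ suc a)) ≡⟨ cong₂ (λ x y → y * (x C y)) (pred-∸ a<n) (pred-∸ a<k) ⟨
  (k ∸ a) * ((n ∸ a) C (k ∸ a))                        ≡⟨ *-comm (k ∸ a) _ ⟩
  ((n ∸ a) C (k ∸ a)) * (k ∸ a)                        ≡⟨ cong (_* (k ∸ a)) (binomSub-≤ n k (<⇒≤ a<k)) ⟨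
  binomSub n k a * (k ∸ a)                             ∎
  where
  a<k = ≰⇒> k≰a
  pred-∸ : ∀ {m} → a < m → m ∸ a ≡ suc (m ∸ suc a)
  pred-∸ {suc m} (s≤s a≤m) = +-∸-assoc 1 a≤m

prodBinom-suc : ∀ {p} (ns ks a : Fin p → ℕ) i → a i < ns i →
                prodBinom ns ks (updateAt a i suc) * (ns i ∸ a i) ≡ prodBinom ns ks a * (ks i ∸ a i)
prodBinom-suc ns ks a i a<n = prod-scale-at _ _ i
  (λ j j≢i → cong (binomSub (ns j) (ks j)) (updateAt-minimal j i a j≢i))
  (trans (cong (λ z → binomSub (ns i) (ks i) z * (ns i ∸ a i)) (updateAt-updates i a)) (binomSub-suc (ns i) (ks i) a<n))

-- The factor `(k - c) / (n - c)` is at most its value `k / n` at `c = 0`, because `k ≤ n`. This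
-- removes the dependence on the points already chosen.
prodBinom-suc-≤ : ∀ {p} (ns ks a : Fin p → ℕ) i → ks i ≤ ns i → a i < ns i →
                  prodBinom ns ks (updateAt a i suc) * ns i ≤ prodBinom ns ks a * ks i
prodBinom-suc-≤ ns ks a i k≤n a<n = *-cancelʳ-≤ _ _ (n ∸ c) {{>-nonZero (m<n⇒0<n∸m a<n)}} (begin
  P′ * n * (n ∸ c)    ≡⟨ xy∙z≡xz∙y P′ n (n ∸ c) ⟩
  P′ * (n ∸ c) * n    ≡⟨ cong (_* n) (prodBinom-suc ns ks a i a<n) ⟩
  P * (k ∸ c) * n     ≡⟨ *-assoc P _ n ⟩
  P * ((k ∸ c) * n)   ≤⟨ *-monoʳ-≤ P cross ⟩
  P * (k * (n ∸ c))   ≡⟨ *-assoc P k _ ⟨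
  P * k * (n ∸ c)     ∎)
  where
  n = ns i
  k = ks i
  c = a i
  P = prodBinom ns ks a
  P′ = prodBinom ns ks (updateAt a i suc)
  cross : (k ∸ c) * n ≤ k * (n ∸ c)
  cross = begin
    (k ∸ c) * n    ≡⟨ *-distribʳ-∸ n k c ⟩
    k * n ∸ c * n  ≤⟨ ∸-monoʳ-≤ (k * n) (*-monoʳ-≤ c k≤n) ⟩
    k * n ∸ c * k  ≡⟨ cong (k * n ∸_) (*-comm c k) ⟩
    k * n ∸ k * c  ≡⟨ *-distribˡ-∸ k n c ⟨
    k * (n ∸ c)    ∎

prodBinom>0⇒total≤ : ∀ {p} (ns ks b : Fin p → ℕ) → 1 ≤ prodBinom ns ks b → total b ≤ total ks
prodBinom>0⇒total≤ ns ks b h =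
  total-mono λ i → binomSub>0⇒≤ (ns i) (ks i) (b i) (prod>0⇒>0 (λ i → binomSub (ns i) (ks i) (b i)) h i)

-- Blocks

variable
  m n p : ℕ

∣++∣ : (A : Subset m) (B : Subset n) → ∣ A ++ B ∣ ≡ ∣ A ∣ + ∣ B ∣
∣++∣ []          B = refl
∣++∣ (true  ∷ A) B = cong suc (∣++∣ A B)
∣++∣ (false ∷ A) B = ∣++∣ A B

tabulate-+ : ∀ {X : Set} m {n} (f : Fin (m + n) → X) →
             tabulate f ≡ tabulate (f ∘ (_↑ˡ n)) ++ tabulate (f ∘ (m ↑ʳ_))
tabulate-+ zero    f = refl
tabulate-+ (suc m) f = cong (f zero ∷_) (tabulate-+ m (f ∘ suc))

tabulate-const : ∀ {X : Set} n (x : X) → tabulate {n = n} (λ _ → x) ≡ replicate n x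
tabulate-const zero    x = refl
tabulate-const (suc n) x = cong (x ∷_) (tabulate-const n x)

⌊⌋-true : ∀ {P : Set} (P? : Dec P) → P → ⌊ P? ⌋ ≡ true
⌊⌋-true (yes _) x = refl
⌊⌋-true (no ¬x) x = contradiction x ¬x

⌊⌋-false : ∀ {P : Set} (P? : Dec P) → ¬ P → ⌊ P? ⌋ ≡ false
⌊⌋-false (yes x) ¬x = contradiction x ¬x
⌊⌋-false (no _)  ¬x = refl

⌊⌋-cong : ∀ {P Q : Set} (P? : Dec P) (Q? : Dec Q) → (P → Q) → (Q → P) → ⌊ P? ⌋ ≡ ⌊ Q? ⌋
⌊⌋-cong P? (yes q) f g = ⌊⌋-true P? (g q)
⌊⌋-cong P? (no ¬q) f g = ⌊⌋-false P? (¬q ∘ f)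

-- Since `total ns` unfolds to `ns zero + total (ns ∘ suc)`, a subset of X is a concatenation
-- `A ++ B`. With `block-suc`, this trades the arithmetic description of the blocks for a recursion
-- on `p`.
block-zero : (ns : Fin (suc p) → ℕ) → block ns zero ≡ ⊤ {ns zero} ++ ⊥
block-zero {p} ns = trans (tabulate-+ (ns zero) _) (cong₂ (_++_ {m = ns zero})
  (trans (tabulate-cong λ x → ⌊⌋-true ((0 ≤? toℕ (x ↑ˡ _)) ×-dec (toℕ (x ↑ˡ _) <? ns zero))
            (z≤n , subst (_< ns zero) (sym (toℕ-↑ˡ x _)) (toℕ<n x))) (tabulate-const (ns zero) true))
  (trans (tabulate-cong λ x → ⌊⌋-false ((0 ≤? toℕ (ns zero ↑ʳ x)) ×-dec (toℕ (ns zero ↑ʳ x) <? ns zero))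
            λ (_ , x<n) → <⇒≱ x<n (subst (ns zero ≤_) (sym (toℕ-↑ʳ (ns zero) x)) (m≤m+n _ _))) (tabulate-const (total (ns ∘ suc)) false)))

block-suc : (ns : Fin (suc p) → ℕ) (i : Fin p) → block ns (suc i) ≡ ⊥ ++ block (ns ∘ suc) i
block-suc ns i = trans (tabulate-+ n₀ _) (cong₂ _++_
  (trans (tabulate-cong λ x → ⌊⌋-false (inBlock (x ↑ˡ _))
            λ (s≤x , _) → <⇒≱ (subst (_< n₀) (sym (toℕ-↑ˡ x _)) (toℕ<n x)) (≤-trans (m≤m+n _ _) s≤x)) (tabulate-const n₀ false))
  (tabulate-cong λ x → ⌊⌋-cong (inBlock (n₀ ↑ʳ x)) ((s ≤? toℕ x) ×-dec (toℕ x <? s + ns (suc i)))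
    (λ (l , u) → +-cancelˡ-≤ n₀ _ _ (subst (n₀ + s ≤_) (toℕ-↑ʳ n₀ x) l)
               , +-cancelˡ-< n₀ _ _ (subst₂ _<_ (toℕ-↑ʳ n₀ x) (+-assoc n₀ s _) u))
    (λ (l , u) → subst (n₀ + s ≤_) (sym (toℕ-↑ʳ n₀ x)) (+-monoʳ-≤ n₀ l)
               , subst₂ _<_ (sym (toℕ-↑ʳ n₀ x)) (sym (+-assoc n₀ s _)) (+-monoʳ-< n₀ u))))
  where
  n₀ = ns zero
  s = sumBefore (ns ∘ suc) i
  inBlock : ∀ x → Dec _
  inBlock x = (n₀ + s ≤? toℕ x) ×-dec (toℕ x <? n₀ + s + ns (suc i))

blockCount-zero : (ns : Fin (suc p) → ℕ) (A : Subset (ns zero)) (B : Subset (total (ns ∘ suc))) →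
                  blockCount ns (A ++ B) zero ≡ ∣ A ∣
blockCount-zero ns A B = begin-equality
  ∣ (A ++ B) ∩ block ns zero ∣  ≡⟨ cong (λ X → ∣ (A ++ B) ∩ X ∣) (block-zero ns) ⟩
  ∣ (A ++ B) ∩ (⊤ {ns zero} ++ ⊥) ∣ ≡⟨ cong ∣_∣ (zipWith-++ _ A B ⊤ ⊥) ⟩
  ∣ (A ∩ ⊤) ++ (B ∩ ⊥) ∣        ≡⟨ cong₂ (λ X Y → ∣ X ++ Y ∣) (∩-identityʳ A) (∩-zeroʳ B) ⟩
  ∣ A ++ ⊥ ∣                    ≡⟨ ∣++∣ A ⊥ ⟩
  ∣ A ∣ + ∣ ⊥ {total (ns ∘ suc)} ∣ ≡⟨ cong (∣ A ∣ +_) (∣⊥∣≡0 (total (ns ∘ suc))) ⟩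
  ∣ A ∣ + 0                     ≡⟨ +-identityʳ _ ⟩
  ∣ A ∣                         ∎

blockCount-suc : (ns : Fin (suc p) → ℕ) (A : Subset (ns zero)) (B : Subset (total (ns ∘ suc))) (i : Fin p) →
                 blockCount ns (A ++ B) (suc i) ≡ blockCount (ns ∘ suc) B i
blockCount-suc ns A B i = begin-equality
  ∣ (A ++ B) ∩ block ns (suc i) ∣               ≡⟨ cong (λ X → ∣ (A ++ B) ∩ X ∣) (block-suc ns i) ⟩
  ∣ (A ++ B) ∩ (⊥ {ns zero} ++ block (ns ∘ suc) i) ∣      ≡⟨ cong ∣_∣ (zipWith-++ _ A B ⊥ _) ⟩
  ∣ (A ∩ ⊥) ++ (B ∩ block (ns ∘ suc) i) ∣       ≡⟨ cong (λ X → ∣ X ++ (B ∩ block (ns ∘ suc) i) ∣) (∩-zeroʳ A) ⟩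
  ∣ ⊥ {ns zero} ++ (B ∩ block (ns ∘ suc) i) ∣   ≡⟨ ∣++∣ (⊥ {ns zero}) _ ⟩
  ∣ ⊥ {ns zero} ∣ + blockCount (ns ∘ suc) B i   ≡⟨ cong (_+ blockCount (ns ∘ suc) B i) (∣⊥∣≡0 (ns zero)) ⟩
  blockCount (ns ∘ suc) B i                     ∎

total-blockCount : (ns : Fin p → ℕ) (A : Subset (total ns)) → total (blockCount ns A) ≡ ∣ A ∣
total-blockCount {zero}  ns [] = refl
total-blockCount {suc p} ns A with Vec.splitAt (ns zero) A
... | A₀ , A₁ , refl = trans
  (cong₂ _+_ (blockCount-zero ns A₀ A₁) (trans (total-cong (blockCount-suc ns A₀ A₁)) (total-blockCount (ns ∘ suc) A₁)))
  (sym (∣++∣ A₀ A₁))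

initial : ∀ n → ℕ → Subset n
initial zero    a       = []
initial (suc n) zero    = false ∷ initial n zero
initial (suc n) (suc a) = true ∷ initial n a

∣initial∣ : ∀ {n a} → a ≤ n → ∣ initial n a ∣ ≡ a
∣initial∣ {zero}          z≤n       = refl
∣initial∣ {suc n} {zero}  _         = ∣initial∣ {n} z≤n
∣initial∣ {suc n} {suc a} (s≤s a≤n) = cong suc (∣initial∣ a≤n)

-- Turns a numerical profile into a set `T`; needed for the empty family, where no cover provides
-- one.
∃-blockCount : (ns as : Fin p → ℕ) → (∀ i → as i ≤ ns i) → ∃ λ T → ∀ i → blockCount ns T i ≡ as i
∃-blockCount {zero}  ns as a≤n = [] , λ ()
∃-blockCount {suc p} ns as a≤n with ∃-blockCount (ns ∘ suc) (as ∘ suc) (a≤n ∘ suc)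
... | T , eq = initial (ns zero) (as zero) ++ T , λ where
  zero    → trans (blockCount-zero ns (initial (ns zero) (as zero)) T) (∣initial∣ (a≤n zero))
  (suc i) → trans (blockCount-suc ns (initial (ns zero) (as zero)) T i) (eq i)

-- Stars as explicit duplicate-free lists

supersets : Subset n → ℕ → List (Subset n)
supersets []          zero    = [] ∷ []
supersets []          (suc k) = []
supersets (true  ∷ T) zero    = []
supersets (true  ∷ T) (suc k) = map (true ∷_) (supersets T k)
supersets (false ∷ T) zero    = map (false ∷_) (supersets T zero)
supersets (false ∷ T) (suc k) = map (true ∷_) (supersets T k) List.++ map (false ∷_) (supersets T (suc k))

∈-supersets⁺ : (T A : Subset n) → T ⊆ A → A ∈ supersets T ∣ A ∣
∈-supersets⁺ []          []          T⊆A = here refl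
∈-supersets⁺ (true  ∷ T) (true  ∷ A) T⊆A = ∈-map⁺ (true ∷_) (∈-supersets⁺ T A (drop-∷-⊆ T⊆A))
∈-supersets⁺ (true  ∷ T) (false ∷ A) T⊆A with () ← T⊆A here
∈-supersets⁺ (false ∷ T) (true  ∷ A) T⊆A = ∈-++⁺ˡ (∈-map⁺ (true ∷_) (∈-supersets⁺ T A (drop-∷-⊆ T⊆A)))
∈-supersets⁺ (false ∷ T) (false ∷ A) T⊆A with ∣ A ∣ | ∈-supersets⁺ T A (drop-∷-⊆ T⊆A)
... | zero  | A∈ = ∈-map⁺ (false ∷_) A∈
... | suc k | A∈ = ∈-++⁺ʳ (map (true ∷_) (supersets T k)) (∈-map⁺ (false ∷_) A∈)

∈-supersets⁻ : (T : Subset n) {A : Subset n} (k : ℕ) → A ∈ supersets T k → T ⊆ A × ∣ A ∣ ≡ k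
∈-supersets⁻ []          zero    (here refl) = id , refl
∈-supersets⁻ (true  ∷ T) (suc k) A∈ with ∈-map⁻ (true ∷_) A∈
... | A , A∈′ , refl with ∈-supersets⁻ T k A∈′
... | T⊆A , refl = s⊆s T⊆A , refl
∈-supersets⁻ (false ∷ T) zero    A∈ with ∈-map⁻ (false ∷_) A∈
... | A , A∈′ , refl with ∈-supersets⁻ T zero A∈′
... | T⊆A , eq = s⊆s T⊆A , eq
∈-supersets⁻ (false ∷ T) (suc k) A∈ with ∈-++⁻ (map (true ∷_) (supersets T k)) A∈
... | inj₁ A∈₁ with ∈-map⁻ (true ∷_) A∈₁
... | A , A∈′ , refl with ∈-supersets⁻ T k A∈′
... | T⊆A , refl = out⊆ T⊆A , refl
∈-supersets⁻ (false ∷ T) (suc k) A∈ | inj₂ A∈₂ with ∈-map⁻ (false ∷_) A∈₂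
... | A , A∈′ , refl with ∈-supersets⁻ T (suc k) A∈′
... | T⊆A , eq = s⊆s T⊆A , eq

supersets-unique : (T : Subset n) (k : ℕ) → Unique (supersets T k)
supersets-unique []          zero    = [] ∷ []
supersets-unique []          (suc k) = []
supersets-unique (true  ∷ T) zero    = []
supersets-unique (true  ∷ T) (suc k) = Unique.map⁺ ∷-injectiveʳ (supersets-unique T k)
supersets-unique (false ∷ T) zero    = Unique.map⁺ ∷-injectiveʳ (supersets-unique T zero)
supersets-unique (false ∷ T) (suc k) = Unique.++⁺
  (Unique.map⁺ ∷-injectiveʳ (supersets-unique T k)) (Unique.map⁺ ∷-injectiveʳ (supersets-unique T (suc k)))
  λ (A∈₁ , A∈₂) → heads-differ (proj₂ (proj₂ (∈-map⁻ (true ∷_) A∈₁))) (proj₂ (proj₂ (∈-map⁻ (false ∷_) A∈₂)))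
  where
  heads-differ : ∀ {n} {A : Subset (suc n)} {B C} → A ≡ true ∷ B → A ≢ false ∷ C
  heads-differ refl ()

-- A point of `T` is forced and lowers all three arguments of `binomSub` at once; a point outside
-- `T` is free, and its two options are the summands of Pascal's rule.
length-supersets : (T : Subset n) (k : ℕ) → length (supersets T k) ≡ binomSub n k ∣ T ∣
length-supersets []          zero    = refl
length-supersets []          (suc k) = sym (k>n⇒nCk≡0 {0} {suc k} (s≤s z≤n))
length-supersets (true  ∷ T) zero    = refl
length-supersets {suc n} (true ∷ T) (suc k) = trans (length-map _ (supersets T k))
  (trans (length-supersets T k) (sym (binomSub-suc-suc-suc n k ∣ T ∣)))
length-supersets {suc n} (false ∷ T) zero = trans (length-map _ (supersets T zero))
  (trans (length-supersets T zero) (k=0 ∣ T ∣))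
  where
  k=0 : ∀ a → binomSub n 0 a ≡ binomSub (suc n) 0 a
  k=0 zero    = refl
  k=0 (suc a) = refl
length-supersets {suc n} (false ∷ T) (suc k) = begin-equality
  length (map (true ∷_) (supersets T k) List.++ map (false ∷_) (supersets T (suc k)))
    ≡⟨ length-++ (map (true ∷_) (supersets T k)) ⟩
  length (map (true ∷_) (supersets T k)) + length (map (false ∷_) (supersets T (suc k)))
    ≡⟨ cong₂ _+_ (trans (length-map _ (supersets T k)) (length-supersets T k))
                 (trans (length-map _ (supersets T (suc k))) (length-supersets T (suc k))) ⟩
  binomSub n k ∣ T ∣ + binomSub n (suc k) ∣ T ∣  ≡⟨ binomSub-pascal k (∣p∣≤n T) ⟩
  binomSub (suc n) (suc k) ∣ T ∣                 ∎

-- The members of H₁ containing `T`, in a form whose length can be compared with that of `𝓕`. The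
-- choices in different blocks are independent, which is why the count is a product of binomials.
star : (ns ks : Fin p → ℕ) → Subset (total ns) → List (Subset (total ns))
star {zero}  ns ks T = [] ∷ []
star {suc p} ns ks T = cartesianProductWith _++_
  (supersets (Vec.take (ns zero) T) (ks zero)) (star (ns ∘ suc) (ks ∘ suc) (Vec.drop (ns zero) T))

length-cartesianProductWith : ∀ {X Y Z : Set} (f : X → Y → Z) xs ys →
                              length (cartesianProductWith f xs ys) ≡ length xs * length ys
length-cartesianProductWith f []       ys = refl
length-cartesianProductWith f (x ∷ xs) ys = trans (length-++ (map (f x) ys))
  (cong₂ _+_ (length-map (f x) ys) (length-cartesianProductWith f xs ys))

length-star : (ns ks : Fin p → ℕ) (T : Subset (total ns)) → length (star ns ks T) ≡ prodBinom ns ks (blockCount ns T)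
length-star {zero}  ns ks T = refl
length-star {suc p} ns ks T with Vec.splitAt (ns zero) T
... | T₀ , T₁ , refl = trans (length-cartesianProductWith _++_ (supersets T₀ (ks zero)) _) (cong₂ _*_
  (trans (length-supersets T₀ (ks zero)) (cong (binomSub (ns zero) (ks zero)) (sym (blockCount-zero ns T₀ T₁))))
  (trans (length-star (ns ∘ suc) (ks ∘ suc) T₁)
    (prod-cong λ i → cong (binomSub (ns (suc i)) (ks (suc i))) (sym (blockCount-suc ns T₀ T₁ i)))))

star-unique : (ns ks : Fin p → ℕ) (T : Subset (total ns)) → Unique (star ns ks T)
star-unique {zero}  ns ks T = [] ∷ []
star-unique {suc p} ns ks T = Unique.cartesianProductWith⁺ _++_ (λ {A} {B} → ++-injective A B)
  (supersets-unique (Vec.take (ns zero) T) (ks zero)) (star-unique (ns ∘ suc) (ks ∘ suc) (Vec.drop (ns zero) T))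

++-⊆⁻ : (S A : Subset m) {S′ A′ : Subset n} → S ++ S′ ⊆ A ++ A′ → S ⊆ A × S′ ⊆ A′
++-⊆⁻ []      []      S⊆A = (λ ()) , S⊆A
++-⊆⁻ (s ∷ S) (a ∷ A) S⊆A with ++-⊆⁻ S A (drop-∷-⊆ S⊆A)
... | S⊆A₀ , S⊆A₁ = (λ { here → head⊆ (S⊆A here) ; (there x∈S) → there (S⊆A₀ x∈S) }) , S⊆A₁
  where
  head⊆ : ∀ {k l} {B : Subset k} {C : Subset l} → (a ∷ B) Vec.[ zero ]= true → (a ∷ C) Vec.[ zero ]= true
  head⊆ here = here

++-⊆⁺ : (S A : Subset m) {S′ A′ : Subset n} → S ⊆ A → S′ ⊆ A′ → S ++ S′ ⊆ A ++ A′
++-⊆⁺ []      []      S⊆A₀ S⊆A₁ x∈          = S⊆A₁ x∈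
++-⊆⁺ (s ∷ S) (a ∷ A) S⊆A₀ S⊆A₁ {zero}  here with here ← S⊆A₀ here = here
++-⊆⁺ (s ∷ S) (a ∷ A) S⊆A₀ S⊆A₁ {suc x} (there x∈) = there (++-⊆⁺ S A (drop-∷-⊆ S⊆A₀) S⊆A₁ x∈)

∈-star⁺ : (ns ks : Fin p → ℕ) (T A : Subset (total ns)) →
          (∀ i → blockCount ns A i ≡ ks i) → T ⊆ A → A ∈ star ns ks T
∈-star⁺ {zero}  ns ks T [] _ _ = here refl
∈-star⁺ {suc p} ns ks T A A≡k T⊆A with Vec.splitAt (ns zero) T | Vec.splitAt (ns zero) A
... | T₀ , T₁ , refl | A₀ , A₁ , refl = ∈-cartesianProductWith⁺ _++_
  (subst (λ k → A₀ ∈ supersets T₀ k) (trans (sym (blockCount-zero ns A₀ A₁)) (A≡k zero))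
    (∈-supersets⁺ T₀ A₀ (proj₁ (++-⊆⁻ T₀ A₀ T⊆A))))
  (∈-star⁺ (ns ∘ suc) (ks ∘ suc) T₁ A₁ (λ i → trans (sym (blockCount-suc ns A₀ A₁ i)) (A≡k (suc i)))
    (proj₂ (++-⊆⁻ T₀ A₀ T⊆A)))

∈-star⁻ : (ns ks : Fin p → ℕ) (T : Subset (total ns)) {A : Subset (total ns)} →
          A ∈ star ns ks T → (∀ i → blockCount ns A i ≡ ks i) × T ⊆ A
∈-star⁻ {zero}  ns ks [] (here refl) = (λ ()) , id
∈-star⁻ {suc p} ns ks T A∈ with Vec.splitAt (ns zero) T
... | T₀ , T₁ , refl with ∈-cartesianProductWith⁻ _++_ (supersets T₀ (ks zero)) (star (ns ∘ suc) (ks ∘ suc) T₁) A∈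
... | A₀ , A₁ , A₀∈ , A₁∈ , refl with ∈-supersets⁻ T₀ (ks zero) A₀∈ | ∈-star⁻ (ns ∘ suc) (ks ∘ suc) T₁ A₁∈
... | T⊆A₀ , ∣A₀∣≡k | A₁≡k , T⊆A₁ =
  (λ { zero → trans (blockCount-zero ns A₀ A₁) ∣A₀∣≡k ; (suc i) → trans (blockCount-suc ns A₀ A₁ i) (A₁≡k i) }) ,
  ++-⊆⁺ T₀ A₀ T⊆A₀ T⊆A₁

-- Adding a point to a set, and sums over the points of a set

blockOf : (ns : Fin p → ℕ) → Fin (total ns) → Fin p
blockOf {suc p} ns x = [ (λ _ → zero) , suc ∘ blockOf (ns ∘ suc) ]′ (Fin.splitAt (ns zero) x)

∣insert∣ : (S : Subset n) (x : Fin n) → lookup S x ≡ false → ∣ S [ x ]≔ true ∣ ≡ suc ∣ S ∣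
∣insert∣ (false ∷ S) zero    _   = refl
∣insert∣ (true  ∷ S) (suc x) x∉S = cong suc (∣insert∣ S x x∉S)
∣insert∣ (false ∷ S) (suc x) x∉S = ∣insert∣ S x x∉S

blockCount-insert : (ns : Fin p → ℕ) (S : Subset (total ns)) (x : Fin (total ns)) → lookup S x ≡ false →
                    ∀ i → blockCount ns (S [ x ]≔ true) i ≡ updateAt (blockCount ns S) (blockOf ns x) suc i
blockCount-insert {suc p} ns S x x∉S i with Vec.splitAt (ns zero) S | Fin.splitAt (ns zero) x in eq
... | S₀ , S₁ , refl | inj₁ y with splitAt⁻¹-↑ˡ eq
blockCount-insert {suc p} ns S x x∉S zero | S₀ , S₁ , refl | inj₁ y | refl = begin-equality
  blockCount ns ((S₀ ++ S₁) [ y ↑ˡ _ ]≔ true) zero  ≡⟨ cong (λ X → blockCount ns X zero) ([]≔-++-↑ˡ S₀ S₁ y) ⟩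
  blockCount ns ((S₀ [ y ]≔ true) ++ S₁) zero       ≡⟨ blockCount-zero ns (S₀ [ y ]≔ true) S₁ ⟩
  ∣ S₀ [ y ]≔ true ∣                                ≡⟨ ∣insert∣ S₀ y (trans (sym (lookup-++ˡ S₀ S₁ y)) x∉S) ⟩
  suc ∣ S₀ ∣                                        ≡⟨ cong suc (blockCount-zero ns S₀ S₁) ⟨
  suc (blockCount ns (S₀ ++ S₁) zero)               ∎
blockCount-insert {suc p} ns S x x∉S (suc i) | S₀ , S₁ , refl | inj₁ y | refl = begin-equality
  blockCount ns ((S₀ ++ S₁) [ y ↑ˡ _ ]≔ true) (suc i)  ≡⟨ cong (λ X → blockCount ns X (suc i)) ([]≔-++-↑ˡ S₀ S₁ y) ⟩
  blockCount ns ((S₀ [ y ]≔ true) ++ S₁) (suc i)       ≡⟨ blockCount-suc ns (S₀ [ y ]≔ true) S₁ i ⟩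
  blockCount (ns ∘ suc) S₁ i                           ≡⟨ blockCount-suc ns S₀ S₁ i ⟨
  blockCount ns (S₀ ++ S₁) (suc i)                     ∎
blockCount-insert {suc p} ns S x x∉S i | S₀ , S₁ , refl | inj₂ y with splitAt⁻¹-↑ʳ {ns zero} eq
blockCount-insert {suc p} ns S x x∉S zero | S₀ , S₁ , refl | inj₂ y | refl = begin-equality
  blockCount ns ((S₀ ++ S₁) [ ns zero ↑ʳ y ]≔ true) zero  ≡⟨ cong (λ X → blockCount ns X zero) ([]≔-++-↑ʳ S₀ S₁ y) ⟩
  blockCount ns (S₀ ++ (S₁ [ y ]≔ true)) zero             ≡⟨ blockCount-zero ns S₀ _ ⟩
  ∣ S₀ ∣                                                  ≡⟨ blockCount-zero ns S₀ S₁ ⟨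
  blockCount ns (S₀ ++ S₁) zero                           ∎
blockCount-insert {suc p} ns S x x∉S (suc i) | S₀ , S₁ , refl | inj₂ y | refl = begin-equality
  blockCount ns ((S₀ ++ S₁) [ ns zero ↑ʳ y ]≔ true) (suc i)  ≡⟨ cong (λ X → blockCount ns X (suc i)) ([]≔-++-↑ʳ S₀ S₁ y) ⟩
  blockCount ns (S₀ ++ (S₁ [ y ]≔ true)) (suc i)             ≡⟨ blockCount-suc ns S₀ _ i ⟩
  blockCount (ns ∘ suc) (S₁ [ y ]≔ true) i
    ≡⟨ blockCount-insert (ns ∘ suc) S₁ y (trans (sym (lookup-++ʳ S₀ S₁ y)) x∉S) i ⟩
  updateAt (blockCount (ns ∘ suc) S₁) (blockOf (ns ∘ suc) y) suc i
    ≡⟨ updateAt-cong-local (λ j → sym (blockCount-suc ns S₀ S₁ j)) (blockOf (ns ∘ suc) y) i ⟩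
  updateAt (λ j → blockCount ns (S₀ ++ S₁) (suc j)) (blockOf (ns ∘ suc) y) suc i ∎
  where
  updateAt-cong-local : ∀ {p} {f g : Fin p → ℕ} → (∀ i → f i ≡ g i) → ∀ j i → updateAt f j suc i ≡ updateAt g j suc i
  updateAt-cong-local h zero    zero    = cong suc (h zero)
  updateAt-cong-local h zero    (suc i) = h (suc i)
  updateAt-cong-local h (suc j) zero    = h zero
  updateAt-cong-local h (suc j) (suc i) = updateAt-cong-local (h ∘ suc) j i

sumOver : Subset n → (Fin n → ℕ) → ℕ
sumOver []          f = 0
sumOver (true  ∷ B) f = f zero + sumOver B (f ∘ suc)
sumOver (false ∷ B) f = sumOver B (f ∘ suc)

sumOver-++ : (A : Subset m) (B : Subset n) (f : Fin (m + n) → ℕ) →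
             sumOver (A ++ B) f ≡ sumOver A (f ∘ (_↑ˡ n)) + sumOver B (f ∘ (m ↑ʳ_))
sumOver-++ []          B f = refl
sumOver-++ (true  ∷ A) B f = trans (cong (f zero +_) (sumOver-++ A B (f ∘ suc))) (sym (+-assoc (f zero) _ _))
sumOver-++ (false ∷ A) B f = sumOver-++ A B (f ∘ suc)

sumOver-≤ : (A : Subset n) (f : Fin n → ℕ) (c {M} : ℕ) → (∀ x → f x * c ≤ M) → sumOver A f * c ≤ ∣ A ∣ * M
sumOver-≤ []          f c h = z≤n
sumOver-≤ (true  ∷ A) f c h = ≤-trans (≤-reflexive (*-distribʳ-+ c (f zero) _)) (+-mono-≤ (h zero) (sumOver-≤ A (f ∘ suc) c (h ∘ suc)))
sumOver-≤ (false ∷ A) f c h = sumOver-≤ A (f ∘ suc) c (h ∘ suc)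

-- The weight `ks (blockOf ns x)` in the bound on `f x` compensates for the number of points of `B`
-- in that block, so every block contributes at most `M`.
sumOver-block-≤ : (ns ks : Fin p → ℕ) (B : Subset (total ns)) (f : Fin (total ns) → ℕ) (c {M} : ℕ) →
                  (∀ i → 1 ≤ ks i) → (∀ i → blockCount ns B i ≤ ks i) →
                  (∀ x → f x * (c * ks (blockOf ns x)) ≤ M) → sumOver B f * c ≤ p * M
sumOver-block-≤ {zero}  ns ks [] f c _ _ _ = z≤n
sumOver-block-≤ {suc p} ns ks B  f c {M} 1≤k B≤k h with Vec.splitAt (ns zero) B
... | B₀ , B₁ , refl = begin
  sumOver (B₀ ++ B₁) f * c        ≡⟨ cong (_* c) (sumOver-++ B₀ B₁ f) ⟩
  (s₀ + s₁) * c                   ≡⟨ *-distribʳ-+ c s₀ s₁ ⟩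
  s₀ * c + s₁ * c                 ≤⟨ +-mono-≤ first rest ⟩
  M + p * M                       ∎
  where
  f₀ = f ∘ (_↑ˡ total (ns ∘ suc))
  f₁ = f ∘ (ns zero ↑ʳ_)
  s₀ = sumOver B₀ f₀
  s₁ = sumOver B₁ f₁
  first : s₀ * c ≤ M
  first = *-cancelˡ-≤ (ks zero) {{>-nonZero (1≤k zero)}} (begin
    ks zero * (s₀ * c)      ≡⟨ trans (*-comm (ks zero) _) (*-assoc s₀ c _) ⟩
    s₀ * (c * ks zero)      ≤⟨ sumOver-≤ B₀ f₀ (c * ks zero) (λ x → subst (λ i → f₀ x * (c * ks i) ≤ M) (blockOf-↑ˡ x) (h (x ↑ˡ _))) ⟩
    ∣ B₀ ∣ * M              ≤⟨ *-monoˡ-≤ M (subst (_≤ ks zero) (blockCount-zero ns B₀ B₁) (B≤k zero)) ⟩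
    ks zero * M             ∎)
    where
    blockOf-↑ˡ : ∀ x → blockOf ns (x ↑ˡ _) ≡ zero
    blockOf-↑ˡ x = cong [ (λ _ → zero) , suc ∘ blockOf (ns ∘ suc) ]′ (splitAt-↑ˡ (ns zero) x _)
  rest : s₁ * c ≤ p * M
  rest = sumOver-block-≤ (ns ∘ suc) (ks ∘ suc) B₁ f₁ c (1≤k ∘ suc)
    (λ i → subst (_≤ ks (suc i)) (blockCount-suc ns B₀ B₁ i) (B≤k (suc i)))
    (λ x → subst (λ i → f₁ x * (c * ks i) ≤ M) (blockOf-↑ʳ x) (h (ns zero ↑ʳ x)))
    where
    blockOf-↑ʳ : ∀ x → blockOf ns (ns zero ↑ʳ x) ≡ suc (blockOf (ns ∘ suc) x)
    blockOf-↑ʳ x = cong [ (λ _ → zero) , suc ∘ blockOf (ns ∘ suc) ]′ (splitAt-↑ʳ (ns zero) _ x)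

-- Covers and branching

module _ {X : Set} where
  unique-⊆⇒length≤ : {xs ys : List X} → Unique xs → (∀ {x} → x ∈ xs → x ∈ ys) → length xs ≤ length ys
  unique-⊆⇒length≤ []         xs⊆ys = z≤n
  unique-⊆⇒length≤ (_∷_ {x} {xs} x≢ u) xs⊆ys with ∈-∃++ (xs⊆ys (here refl))
  ... | as , bs , refl = subst (suc (length xs) ≤_) (sym (length-++-sucʳ as x bs))
    (s≤s (unique-⊆⇒length≤ u λ z∈xs → drop-x (∈-++⁻ as (xs⊆ys (there z∈xs))) (λ { refl → All.lookup x≢ z∈xs refl })))
    where
    drop-x : ∀ {z} → z ∈ as ⊎ z ∈ x ∷ bs → z ≢ x → z ∈ as List.++ bs
    drop-x (inj₁ z∈as)         _   = ∈-++⁺ˡ z∈as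
    drop-x (inj₂ (here z≡x))   z≢x = contradiction z≡x z≢x
    drop-x (inj₂ (there z∈bs)) _   = ∈-++⁺ʳ as z∈bs

  -- A missing `y` could be put in front of `xs`, giving a duplicate-free list inside `ys` that is
  -- longer than `ys`.
  unique-⊆∧length≥⇒⊇ : (∀ (x y : X) → Dec (x ≡ y)) → {xs ys : List X} → Unique xs → (∀ {x} → x ∈ xs → x ∈ ys) →
                       length ys ≤ length xs → ∀ {y} → y ∈ ys → y ∈ xs
  unique-⊆∧length≥⇒⊇ _≟_ {xs} u xs⊆ys ys≤xs {y} y∈ys with DecMembership._∈?_ _≟_ y xs
  ... | yes y∈xs = y∈xs
  ... | no  y∉xs = contradiction
    (unique-⊆⇒length≤ (¬Any⇒All¬ xs y∉xs ∷ u) λ { (here refl) → y∈ys ; (there x∈) → xs⊆ys x∈ }) (≤⇒≯ ys≤xs)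

∈⇒length>0 : {X : Set} {x : X} {xs : List X} → x ∈ xs → 0 < length xs
∈⇒length>0 (here _)  = s≤s z≤n
∈⇒length>0 (there _) = s≤s z≤n

-- Abstracts from the shape of the index sum, so that one union bound serves both the points of `B`
-- and the `t`-subsets of `Y`.
StrictlyMonotone : {I : Set} → (I → Set) → ((I → ℕ) → ℕ) → Set
StrictlyMonotone Idx Σ = ∀ {f g} {i} → Idx i → (∀ j → f j ≤ g j) → f i < g i → Σ f < Σ g

-- Each new element of `xs` lengthens the filtered list of an admissible index and shortens none, so
-- by strict monotonicity the sum grows by at least one.
union-bound : {I X : Set} {Idx : I → Set} {Σ : (I → ℕ) → ℕ} → StrictlyMonotone Idx Σ →
              {P : I → X → Set} (P? : ∀ i → Decidable (P i)) (xs : List X) →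
              (∀ {x} → x ∈ xs → ∃ λ i → Idx i × P i x) →
              length xs ≤ Σ (λ i → length (filter (P? i) xs))
union-bound mono P? []       cover = z≤n
union-bound mono P? (x ∷ xs) cover with cover (here refl)
... | i , idx , Pix = ≤-<-trans (union-bound mono P? xs (cover ∘ there)) (mono idx grow
  (≤-reflexive (cong length (sym (filter-accept (P? i) Pix)))))
  where
  grow : ∀ j → length (filter (P? j) xs) ≤ length (filter (P? j) (x ∷ xs))
  grow j with P? j x
  ... | yes _ = n≤1+n _
  ... | no  _ = ≤-refl

sum-map-mono : {I : Set} {f g : I → ℕ} (L : List I) → (∀ j → f j ≤ g j) → sum (map f L) ≤ sum (map g L)
sum-map-mono []      f≤g = z≤n
sum-map-mono (i ∷ L) f≤g = +-mono-≤ (f≤g i) (sum-map-mono L f≤g)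

sum-map-strictlyMonotone : {I : Set} (L : List I) → StrictlyMonotone (_∈ L) (λ f → sum (map f L))
sum-map-strictlyMonotone (i ∷ L) (here refl) f≤g fi<gi = +-mono-<-≤ fi<gi (sum-map-mono L f≤g)
sum-map-strictlyMonotone (j ∷ L) (there i∈L) f≤g fi<gi = +-mono-≤-< (f≤g j) (sum-map-strictlyMonotone L i∈L f≤g fi<gi)

sum-map-*-≤ : {I : Set} (L : List I) (f : I → ℕ) (c {M} : ℕ) → (∀ {i} → i ∈ L → f i * c ≤ M) → sum (map f L) * c ≤ length L * M
sum-map-*-≤ []      f c h = z≤n
sum-map-*-≤ (i ∷ L) f c h = ≤-trans (≤-reflexive (*-distribʳ-+ c (f i) _)) (+-mono-≤ (h (here refl)) (sum-map-*-≤ L f c (h ∘ there)))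

sumOver-mono : (B : Subset n) {f g : Fin n → ℕ} → (∀ x → f x ≤ g x) → sumOver B f ≤ sumOver B g
sumOver-mono []          f≤g = z≤n
sumOver-mono (true  ∷ B) f≤g = +-mono-≤ (f≤g zero) (sumOver-mono B (f≤g ∘ suc))
sumOver-mono (false ∷ B) f≤g = sumOver-mono B (f≤g ∘ suc)

sumOver-strictlyMonotone : (B : Subset n) → StrictlyMonotone (Subset._∈ B) (sumOver B)
sumOver-strictlyMonotone (true  ∷ B) here        f≤g fi<gi = +-mono-<-≤ fi<gi (sumOver-mono B (f≤g ∘ suc))
sumOver-strictlyMonotone (true  ∷ B) (there x∈B) f≤g fi<gi = +-mono-≤-< (f≤g zero) (sumOver-strictlyMonotone B x∈B (f≤g ∘ suc) fi<gi)
sumOver-strictlyMonotone (false ∷ B) (there x∈B) f≤g fi<gi = sumOver-strictlyMonotone B x∈B (f≤g ∘ suc) fi<gi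

subsetsOfSize : Subset n → ℕ → List (Subset n)
subsetsOfSize []          zero    = [] ∷ []
subsetsOfSize []          (suc t) = []
subsetsOfSize (false ∷ Y) t       = map (false ∷_) (subsetsOfSize Y t)
subsetsOfSize (true  ∷ Y) zero    = map (false ∷_) (subsetsOfSize Y zero)
subsetsOfSize (true  ∷ Y) (suc t) = map (true ∷_) (subsetsOfSize Y t) List.++ map (false ∷_) (subsetsOfSize Y (suc t))

length-subsetsOfSize : (Y : Subset n) (t : ℕ) → length (subsetsOfSize Y t) ≡ ∣ Y ∣ C t
length-subsetsOfSize []          zero    = refl
length-subsetsOfSize []          (suc t) = sym (k>n⇒nCk≡0 {0} {suc t} (s≤s z≤n))
length-subsetsOfSize (false ∷ Y) t       = trans (length-map _ (subsetsOfSize Y t)) (length-subsetsOfSize Y t)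
length-subsetsOfSize (true  ∷ Y) zero    = trans (length-map _ (subsetsOfSize Y zero)) (length-subsetsOfSize Y zero)
length-subsetsOfSize (true  ∷ Y) (suc t) = trans (length-++ (map (true ∷_) (subsetsOfSize Y t)))
  (trans (cong₂ _+_ (trans (length-map _ (subsetsOfSize Y t)) (length-subsetsOfSize Y t))
                    (trans (length-map _ (subsetsOfSize Y (suc t))) (length-subsetsOfSize Y (suc t))))
         (nCk+nC[k+1]≡[n+1]C[k+1] ∣ Y ∣ t))

∈-subsetsOfSize⁻ : (Y : Subset n) (t : ℕ) {T : Subset n} → T ∈ subsetsOfSize Y t → ∣ T ∣ ≡ t
∈-subsetsOfSize⁻ []          zero    (here refl) = refl
∈-subsetsOfSize⁻ (false ∷ Y) t       T∈ with ∈-map⁻ (false ∷_) T∈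
... | T , T∈′ , refl = ∈-subsetsOfSize⁻ Y t T∈′
∈-subsetsOfSize⁻ (true  ∷ Y) zero    T∈ with ∈-map⁻ (false ∷_) T∈
... | T , T∈′ , refl = ∈-subsetsOfSize⁻ Y zero T∈′
∈-subsetsOfSize⁻ (true  ∷ Y) (suc t) T∈ with ∈-++⁻ (map (true ∷_) (subsetsOfSize Y t)) T∈
... | inj₁ T∈₁ with ∈-map⁻ (true ∷_) T∈₁
... | T , T∈′ , refl = cong suc (∈-subsetsOfSize⁻ Y t T∈′)
∈-subsetsOfSize⁻ (true  ∷ Y) (suc t) T∈ | inj₂ T∈₂ with ∈-map⁻ (false ∷_) T∈₂
... | T , T∈′ , refl = ∈-subsetsOfSize⁻ Y (suc t) T∈′

∃-subsetOfSize-⊆ : (Y A : Subset n) (t : ℕ) → t ≤ ∣ A ∩ Y ∣ → ∃ λ T → T ∈ subsetsOfSize Y t × T ⊆ A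
∃-subsetOfSize-⊆ []          []          zero    _ = [] , here refl , id
∃-subsetOfSize-⊆ (false ∷ Y) (a     ∷ A) t       h with ∃-subsetOfSize-⊆ Y A t (drop-false a h)
  where
  drop-false : ∀ a → t ≤ ∣ (a ∷ A) ∩ (false ∷ Y) ∣ → t ≤ ∣ A ∩ Y ∣
  drop-false true  h = h
  drop-false false h = h
... | T , T∈ , T⊆A = false ∷ T , ∈-map⁺ (false ∷_) T∈ , out⊆ T⊆A
∃-subsetOfSize-⊆ (true  ∷ Y) (a     ∷ A) zero    h with ∃-subsetOfSize-⊆ Y A zero z≤n
... | T , T∈ , T⊆A = false ∷ T , ∈-map⁺ (false ∷_) T∈ , out⊆ T⊆A
∃-subsetOfSize-⊆ (true  ∷ Y) (true  ∷ A) (suc t) h with ∃-subsetOfSize-⊆ Y A t (s≤s⁻¹ h)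
... | T , T∈ , T⊆A = true ∷ T , ∈-++⁺ˡ (∈-map⁺ (true ∷_) T∈) , s⊆s T⊆A
∃-subsetOfSize-⊆ (true  ∷ Y) (false ∷ A) (suc t) h with ∃-subsetOfSize-⊆ Y A (suc t) h
... | T , T∈ , T⊆A = false ∷ T , ∈-++⁺ʳ (map (true ∷_) (subsetsOfSize Y t)) (∈-map⁺ (false ∷_) T∈) , out⊆ T⊆A

∩-monoˡ-⊆ : {S A : Subset n} (X : Subset n) → S ⊆ A → S ∩ X ⊆ A ∩ X
∩-monoˡ-⊆ {S = S} X S⊆A x∈ = let x∈S , x∈X = x∈p∩q⁻ S X x∈ in x∈p∩q⁺ (S⊆A x∈S , x∈X)

∣∩∣<⇒∃ : (S A B : Subset n) → ∣ S ∩ B ∣ < ∣ A ∩ B ∣ → ∃ λ x → x Subset.∈ B × x Subset.∈ A × x Subset.∉ S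
∣∩∣<⇒∃ S A B lt with any? (λ x → (x ∈ˢ? B) ×-dec (x ∈ˢ? A) ×-dec ¬? (x ∈ˢ? S))
... | yes found = found
... | no  none  = contradiction (p⊆q⇒∣p∣≤∣q∣ A∩B⊆S∩B) (<⇒≱ lt)
  where
  A∩B⊆S∩B : A ∩ B ⊆ S ∩ B
  A∩B⊆S∩B {x} x∈ with x∈p∩q⁻ A B x∈ | x ∈ˢ? S
  ... | x∈A , x∈B | yes x∈S = x∈p∩q⁺ (x∈S , x∈B)
  ... | x∈A , x∈B | no  x∉S = contradiction (x , x∈B , x∈A , x∉S) none

∣∩∣≥⇒⊆ : (A Y : Subset n) → ∣ Y ∣ ≤ ∣ A ∩ Y ∣ → Y ⊆ A
∣∩∣≥⇒⊆ A Y h {x} x∈Y with x ∈ˢ? A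
... | yes x∈A = x∈A
... | no  x∉A = contradiction (p⊂q⇒∣p∣<∣q∣ (p∩q⊆q A Y , x , x∈Y , λ x∈ → x∉A (proj₁ (x∈p∩q⁻ A Y x∈)))) (≤⇒≯ h)

insert-⊆ : {S A : Subset n} {x : Fin n} → S ⊆ A → x Subset.∈ A → S [ x ]≔ true ⊆ A
insert-⊆ {S = S} {x = x} S⊆A x∈A {y} y∈ with x Fin.≟ y
... | yes refl = x∈A
... | no  x≢y  = S⊆A (lookup⇒[]= y S (trans (sym (lookup∘update′ (x≢y ∘ sym) S true)) ([]=⇒lookup y∈)))

Cover : ℕ → List (Subset n) → Subset n → Set
Cover t 𝓕 Y = All (λ A → t ≤ ∣ A ∩ Y ∣) 𝓕

cover? : (t : ℕ) (𝓕 : List (Subset n)) → Decidable (Cover t 𝓕)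
cover? t 𝓕 Y = All.all? (λ A → t ≤? ∣ A ∩ Y ∣) 𝓕

-- `d` is fuel: it bounds the size of the current cover, and every strictly smaller cover uses up
-- one unit.
minimumCover : (t : ℕ) (𝓕 : List (Subset n)) {Y : Subset n} (d : ℕ) → Cover t 𝓕 Y → ∣ Y ∣ ≤ d →
               ∃ λ Y → Cover t 𝓕 Y × (∀ {S} → ∣ S ∣ < ∣ Y ∣ → ¬ Cover t 𝓕 S)
minimumCover t 𝓕 {Y} d cov ∣Y∣≤d with anySubset? (λ S → cover? t 𝓕 S ×-dec (∣ S ∣ <? ∣ Y ∣))
... | no none = Y , cov , λ S<Y S-cov → none (_ , S-cov , S<Y)
minimumCover t 𝓕 zero    cov ∣Y∣≤d | yes (S , _ , S<Y) = contradiction (≤-trans S<Y ∣Y∣≤d) λ ()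
minimumCover t 𝓕 (suc d) cov ∣Y∣≤d | yes (S , S-cov , S<Y) = minimumCover t 𝓕 d S-cov (s≤s⁻¹ (≤-trans S<Y ∣Y∣≤d))

^-distribʳ-* : ∀ r a b → (a * b) ^ r ≡ a ^ r * b ^ r
^-distribʳ-* zero    a b = refl
^-distribʳ-* (suc r) a b = trans (cong (a * b *_) (^-distribʳ-* r a b)) (*-interchange a b (a ^ r) (b ^ r))

module Branching {p t : ℕ} (1≤p : 1 ≤ p) (ns ks : Fin p → ℕ) (1≤k : ∀ i → 1 ≤ ks i) (k≤n : ∀ i → ks i ≤ ns i)
  (𝓕 : List (Subset (total ns))) (𝓕⊆H : ∀ {A} → A ∈ 𝓕 → ∀ i → blockCount ns A i ≡ ks i) (𝓕-int : TIntersecting t 𝓕)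
  (large : ∀ i → 2 * (t + 1) * p * ks i ^ 2 < ns i) where

  E : ℕ
  E = 2 * (t + 1)

  N : Subset (total ns) → ℕ
  N S = prodBinom ns ks (blockCount ns S)

  E*p*k≤E*p*k² : ∀ i → E * p * ks i ≤ E * p * ks i ^ 2
  E*p*k≤E*p*k² i = *-monoʳ-≤ (E * p) (begin
    ks i         ≤⟨ m≤m*n (ks i) (ks i) {{>-nonZero (1≤k i)}} ⟩
    ks i * ks i  ≡⟨ cong (ks i *_) (*-identityʳ (ks i)) ⟨
    ks i ^ 2     ∎)

  t<E : t < E
  t<E = begin-strict
    t      <⟨ m<m+n t (s≤s z≤n) ⟩
    t + 1  ≤⟨ m≤n*m (t + 1) 2 ⟩
    E      ∎

  k<n : ∀ i → ks i < ns i
  k<n i = ≤-<-trans (≤-trans (m≤n*m (ks i) (E * p) {{>-nonZero (*-mono-≤ (≤-<-trans z≤n t<E) 1≤p)}}) (E*p*k≤E*p*k² i)) (large i)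

  t<n : ∀ i → t < ns i
  t<n i = <-trans (<-≤-trans t<E (≤-trans (m≤m*n E (p * ks i) {{>-nonZero (*-mono-≤ 1≤p (1≤k i))}})
    (≤-trans (≤-reflexive (sym (*-assoc E p (ks i)))) (E*p*k≤E*p*k² i)))) (large i)

  -- Of the two factors `k` in `large`, one absorbs the quotient `k / n`; the other stays in the
  -- statement, to be spent on the `k` points of `B` in the same block.
  N-insert : ∀ S x → lookup S x ≡ false → blockCount ns S (blockOf ns x) < ns (blockOf ns x) →
             N (S [ x ]≔ true) * (E * p * ks (blockOf ns x)) ≤ N S
  N-insert S x x∉S a<n = *-cancelʳ-≤ _ _ k {{>-nonZero (1≤k i)}} (begin
    N′ * (E * p * k) * k        ≡⟨ assoc N′ (E * p) k ⟩
    N′ * (E * p * (k * (k * 1))) ≤⟨ *-monoʳ-≤ N′ (<⇒≤ (large i)) ⟩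
    N′ * ns i                   ≡⟨ cong (_* ns i) (prod-cong λ j → cong (binomSub (ns j) (ks j)) (blockCount-insert ns S x x∉S j)) ⟩
    prodBinom ns ks (updateAt (blockCount ns S) i suc) * ns i ≤⟨ prodBinom-suc-≤ ns ks (blockCount ns S) i (k≤n i) a<n ⟩
    N S * k                     ∎)
    where
    i = blockOf ns x
    k = ks i
    N′ = N (S [ x ]≔ true)
    assoc : ∀ a b k → a * (b * k) * k ≡ a * (b * (k * (k * 1)))
    assoc = solve-∀

  star-bound : ∀ S {𝓖} → Unique 𝓖 → (∀ {A} → A ∈ 𝓖 → A ∈ 𝓕 × S ⊆ A) → length 𝓖 ≤ N S
  star-bound S u 𝓖⊆ = subst (_ ≤_) (length-star ns ks S)
    (unique-⊆⇒length≤ u λ A∈ → let A∈𝓕 , S⊆A = 𝓖⊆ A∈ in ∈-star⁺ ns ks S _ (𝓕⊆H A∈𝓕) S⊆A)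

  -- `q` counts the remaining branchings. The hypothesis on covers is preserved, since adding a
  -- point to `S` while lowering `q` keeps `∣ S ∣ + q` fixed. `𝓖` ranges over sublists because the
  -- recursive calls see only the members that contain the new point.
  branch-bound : ∀ q S {𝓖} → Unique 𝓖 → (∀ {A} → A ∈ 𝓖 → A ∈ 𝓕 × S ⊆ A) →
                 (∀ {S′} → ∣ S′ ∣ < ∣ S ∣ + q → ¬ Cover t 𝓕 S′) → length 𝓖 * E ^ q ≤ N S
  branch-bound zero    S {𝓖}     u 𝓖⊆ small = subst (_≤ N S) (sym (*-identityʳ (length 𝓖))) (star-bound S u 𝓖⊆)
  -- The empty case is split off so that otherwise some `A₀ ⊇ S` is at hand: it bounds the block
  -- counts of `S` by `ks`, hence strictly by `ns`, as `N-insert` requires.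
  branch-bound (suc q) S {[]}     u 𝓖⊆ small = z≤n
  branch-bound (suc q) S {𝓖@(A₀ ∷ _)} u 𝓖⊆ small
    with find (¬All⇒Any¬ (λ A → t ≤? ∣ A ∩ S ∣) 𝓕 (small (m<m+n ∣ S ∣ (s≤s z≤n))))
  ... | B , B∈𝓕 , ∣B∩S∣≱t = *-cancelʳ-≤ _ _ p {{>-nonZero 1≤p}} (begin
    length 𝓖 * (E * E ^ q) * p     ≡⟨ assoc (length 𝓖) E (E ^ q) p ⟩
    length 𝓖 * (E ^ q * (E * p))   ≤⟨ *-monoˡ-≤ (E ^ q * (E * p)) (union-bound (sumOver-strictlyMonotone B) new? 𝓖 covered) ⟩
    sumOver B f * (E ^ q * (E * p)) ≤⟨ sumOver-block-≤ ns ks B f (E ^ q * (E * p)) 1≤k (λ i → ≤-reflexive (𝓕⊆H B∈𝓕 i)) each ⟩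
    p * N S                        ≡⟨ *-comm p (N S) ⟩
    N S * p                        ∎)
    where
    assoc : ∀ l a b p → l * (a * b) * p ≡ l * (b * (a * p))
    assoc = solve-∀
    New : Fin (total ns) → Subset (total ns) → Set
    New x A = x Subset.∈ A × x Subset.∉ S
    new? : ∀ x → Decidable (New x)
    new? x A = (x ∈ˢ? A) ×-dec ¬? (x ∈ˢ? S)
    f : Fin (total ns) → ℕ
    f x = length (filter (new? x) 𝓖)
    ∣S∩B∣<t : ∣ S ∩ B ∣ < t
    ∣S∩B∣<t = subst (_< t) (cong ∣_∣ (∩-comm B S)) (≰⇒> ∣B∩S∣≱t)
    covered : ∀ {A} → A ∈ 𝓖 → ∃ λ x → x Subset.∈ B × New x A
    covered {A} A∈ = ∣∩∣<⇒∃ S A B (<-≤-trans ∣S∩B∣<t (𝓕-int (proj₁ (𝓖⊆ A∈)) B∈𝓕))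
    a<n : ∀ i → blockCount ns S i < ns i
    a<n i = let A₀∈𝓕 , S⊆A₀ = 𝓖⊆ (here refl) in
      ≤-<-trans (subst (blockCount ns S i ≤_) (𝓕⊆H A₀∈𝓕 i) (p⊆q⇒∣p∣≤∣q∣ (∩-monoˡ-⊆ (block ns i) S⊆A₀))) (k<n i)
    each : ∀ x → f x * (E ^ q * (E * p) * ks (blockOf ns x)) ≤ N S
    each x with lookup S x in S[x]
    -- The sum runs over all of `B`; the points already in `S` contribute nothing, since `New`
    -- excludes them.
    ... | true  = subst (λ 𝓖ₓ → length 𝓖ₓ * (E ^ q * (E * p) * ks (blockOf ns x)) ≤ N S)
                    (sym (filter-none (new? x) {𝓖} (All.tabulate λ _ (_ , x∉S) → x∉S (lookup⇒[]= x S S[x])))) z≤n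
    ... | false = begin
      f x * (E ^ q * (E * p) * ks i)   ≡⟨ shift (f x) (E ^ q) (E * p) (ks i) ⟩
      f x * E ^ q * (E * p * ks i)     ≤⟨ *-monoˡ-≤ (E * p * ks i) (branch-bound q (S [ x ]≔ true)
           (Unique.filter⁺ (new? x) u) sub (λ {S′} S′< → small (subst (∣ S′ ∣ <_) size S′<))) ⟩
      N (S [ x ]≔ true) * (E * p * ks i) ≤⟨ N-insert S x S[x] (a<n i) ⟩
      N S                              ∎
      where
      i = blockOf ns x
      shift : ∀ a b c d → a * (b * c * d) ≡ a * b * (c * d)
      shift = solve-∀
      size : ∣ S [ x ]≔ true ∣ + q ≡ ∣ S ∣ + suc q
      size = trans (cong (_+ q) (∣insert∣ S x S[x])) (sym (+-suc ∣ S ∣ q))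
      sub : ∀ {A} → A ∈ filter (new? x) 𝓖 → A ∈ 𝓕 × S [ x ]≔ true ⊆ A
      sub A∈ with ∈-filter⁻ (new? x) {xs = 𝓖} A∈
      ... | A∈𝓖 , x∈A , _ = proj₁ (𝓖⊆ A∈𝓖) , insert-⊆ (proj₂ (𝓖⊆ A∈𝓖)) x∈A

  cover-bound : ∀ {m} r Y → Unique 𝓕 → (∀ T → ∣ T ∣ ≡ t → N T ≤ m) → Cover t 𝓕 Y → ∣ Y ∣ ≡ t + r →
                (∀ {S} → ∣ S ∣ < t + r → ¬ Cover t 𝓕 S) → length 𝓕 * 2 ^ r ≤ m
  cover-bound {m} r Y u N≤m cov ∣Y∣≡t+r small = *-cancelʳ-≤ _ _ (suc t ^ r) {{m^n≢0 (suc t) r}} (begin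
    length 𝓕 * 2 ^ r * suc t ^ r    ≡⟨ *-assoc (length 𝓕) (2 ^ r) _ ⟩
    length 𝓕 * (2 ^ r * suc t ^ r)  ≡⟨ cong (length 𝓕 *_) (trans (sym (^-distribʳ-* r 2 (suc t))) (cong (λ z → (2 * z) ^ r) (+-comm 1 t))) ⟩
    length 𝓕 * E ^ r                ≤⟨ *-monoˡ-≤ (E ^ r) (union-bound (sum-map-strictlyMonotone L) _⊆?_ 𝓕
                                        λ {A} A∈ → ∃-subsetOfSize-⊆ Y A t (All.lookup cov A∈)) ⟩
    sum (map f L) * E ^ r           ≤⟨ sum-map-*-≤ L f (E ^ r) each ⟩
    length L * m                    ≡⟨ cong (_* m) (trans (length-subsetsOfSize Y t) (cong (_C t) ∣Y∣≡t+r)) ⟩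
    ((t + r) C t) * m               ≤⟨ *-monoˡ-≤ m (C≤^ t r) ⟩
    suc t ^ r * m                   ≡⟨ *-comm _ m ⟩
    m * suc t ^ r                   ∎)
    where
    L = subsetsOfSize Y t
    f : Subset (total ns) → ℕ
    f T = length (filter (T ⊆?_) 𝓕)
    each : ∀ {T} → T ∈ L → f T * E ^ r ≤ m
    each {T} T∈ = ≤-trans (branch-bound r T (Unique.filter⁺ (T ⊆?_) u) (∈-filter⁻ (T ⊆?_) {xs = 𝓕})
      (λ {S} S< → small (subst (λ z → ∣ S ∣ < z + r) ∣T∣≡t S<))) (N≤m T ∣T∣≡t)
      where ∣T∣≡t = ∈-subsetsOfSize⁻ Y t T∈

  -- Any member of `𝓕` is itself a cover, because `𝓕` is `t`-intersecting, and this starts the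
  -- descent to a minimum cover `Y`. Both `t ≤ ∣ Y ∣` and the strict step from `length 𝓕` to its
  -- double need a member, so the empty family is an alternative of its own.
  empty⊎star⊎small : ∀ {m} → Unique 𝓕 → (∀ T → ∣ T ∣ ≡ t → N T ≤ m) →
               𝓕 ≡ [] ⊎ (∃ λ Y → ∣ Y ∣ ≡ t × (∀ {A} → A ∈ 𝓕 → Y ⊆ A) × ∃ (_∈ 𝓕)) ⊎ length 𝓕 < m
  empty⊎star⊎small {m} u N≤m with nonempty? 𝓕
    where
    nonempty? : (xs : List (Subset (total ns))) → xs ≡ [] ⊎ ∃ (_∈ xs)
    nonempty? []      = inj₁ refl
    nonempty? (x ∷ _) = inj₂ (x , here refl)
  ... | inj₁ 𝓕≡[]       = inj₁ 𝓕≡[]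
  ... | inj₂ (A₀ , A₀∈) with minimumCover t 𝓕 {A₀} ∣ A₀ ∣ (All.tabulate λ A∈ → 𝓕-int A∈ A₀∈) ≤-refl
  ... | Y , cov , minimal = inj₂ (split (∣ Y ∣ ∸ t) (sym (m+[n∸m]≡n t≤∣Y∣)))
    where
    t≤∣Y∣ : t ≤ ∣ Y ∣
    t≤∣Y∣ = ≤-trans (All.lookup cov A₀∈) (∣p∩q∣≤∣q∣ A₀ Y)
    split : ∀ r → ∣ Y ∣ ≡ t + r → (∃ λ Y → ∣ Y ∣ ≡ t × (∀ {A} → A ∈ 𝓕 → Y ⊆ A) × ∃ (_∈ 𝓕)) ⊎ length 𝓕 < m
    split zero    ∣Y∣≡t+0 = inj₁ (Y , ∣Y∣≡t , (λ {A} A∈ → ∣∩∣≥⇒⊆ A Y (subst (_≤ ∣ A ∩ Y ∣) (sym ∣Y∣≡t) (All.lookup cov A∈))) , A₀ , A₀∈)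
      where ∣Y∣≡t = trans ∣Y∣≡t+0 (+-identityʳ t)
    split (suc r) ∣Y∣≡t+r = inj₂ (begin-strict
      length 𝓕               <⟨ m<m*n (length 𝓕) 2 {{>-nonZero (∈⇒length>0 A₀∈)}} (s≤s (s≤s z≤n)) ⟩
      length 𝓕 * 2           ≤⟨ *-monoʳ-≤ (length 𝓕) (m≤m*n 2 (2 ^ r) {{m^n≢0 2 r}}) ⟩
      length 𝓕 * 2 ^ suc r   ≤⟨ cover-bound (suc r) Y u N≤m cov ∣Y∣≡t+r (λ {S} S< → minimal (subst (∣ S ∣ <_) (sym ∣Y∣≡t+r) S<)) ⟩
      m                      ∎)

-- Optimal profiles

total-mono-< : ∀ {p} {f g : Fin p → ℕ} → (∀ i → f i ≤ g i) → ∀ i → f i < g i → total f < total g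
total-mono-< h zero    lt = +-mono-<-≤ lt (total-mono (h ∘ suc))
total-mono-< h (suc i) lt = +-mono-≤-< (h zero) (total-mono-< (h ∘ suc) i lt)

-- Used in two ways: for the maximum in the greedy choice, and with the order reversed for a minimum
-- over the coordinates with `1 ≤ a i`.
∃-max : ∀ {p} {Q : Fin p → Set} (Q? : Decidable Q) {R : Fin p → Fin p → Set} →
        (∀ i j → R i j ⊎ R j i) → (∀ {i j k} → R i j → R j k → R i k) →
        ∃ Q → ∃ λ j → Q j × (∀ i → Q i → R i j)
∃-max {zero}  Q? R-total R-trans (() , _)
∃-max {suc p} {Q} Q? {R} R-total R-trans (w , Qw) with any? (Q? ∘ suc)
... | no none = zero , head w Qw , λ where
    zero    _  → [ id , id ]′ (R-total zero zero)
    (suc i) Qi → contradiction (i , Qi) none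
  where
  head : ∀ w → Q w → Q zero
  head zero    Qw = Qw
  head (suc w) Qw = contradiction (w , Qw) none
... | yes some with ∃-max (Q? ∘ suc) (λ i j → R-total (suc i) (suc j)) R-trans some
...   | j , Qj , j-max with Q? zero | R-total zero (suc j)
...     | no ¬Q0 | _ = suc j , Qj , λ { zero Q0 → contradiction Q0 ¬Q0 ; (suc i) Qi → j-max i Qi }
...     | yes Q0 | inj₁ 0≤j = suc j , Qj , λ { zero _ → 0≤j ; (suc i) Qi → j-max i Qi }
...     | yes Q0 | inj₂ j≤0 = zero , Q0 , λ { zero _ → [ id , id ]′ (R-total zero zero) ; (suc i) Qi → R-trans (j-max i Qi) j≤0 }

unimodal-max : (Q : ℕ → ℕ) (a t : ℕ) → (∀ c → a ≤ c → c < t → Q (suc c) ≤ Q c) → (∀ c → c < a → Q c ≤ Q (suc c)) →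
               ∀ {b} → b ≤ t → Q b ≤ Q a
unimodal-max Q a t down up {b} b≤t with ≤-total a b
... | inj₁ a≤b = right (≤⇒≤′ a≤b) b≤t
  where
  right : ∀ {b} → a ≤′ b → b ≤ t → Q b ≤ Q a
  right (≤′-reflexive refl) _   = ≤-refl
  right (≤′-step a≤′b)      b<t = ≤-trans (down _ (≤′⇒≤ a≤′b) b<t) (right a≤′b (<⇒≤ b<t))
... | inj₂ b≤a = left (≤⇒≤‴ b≤a)
  where
  left : ∀ {b} → b ≤‴ a → Q b ≤ Q a
  left (≤‴-reflexive refl) = ≤-refl
  left (≤‴-step b<a)       = ≤-trans (up _ (≤‴⇒≤ b<a)) (left b<a)

∸-split : ∀ {c k n} → c ≤ k → k ≤ n → n ∸ c ≡ (k ∸ c) + (n ∸ k)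
∸-split {c} {k} {n} c≤k k≤n = trans (cong (_∸ c) (sym (m+[n∸m]≡n k≤n))) (+-∸-comm (n ∸ k) c≤k)

module _ (x y d e : ℕ) where
  -- Passing to complements: `x / (x + d) = 1 - d / (x + d)`. Here and in `cross⁻` both inequalities
  -- reduce to `x * e ≤ y * d`; `∸-split` brings the denominators into this shape.
  cross⁺ : e * (x + d) ≤ d * (y + e) → x * (y + e) ≤ y * (x + d)
  cross⁺ h = begin
    x * (y + e)    ≡⟨ *-distribˡ-+ x y e ⟩
    x * y + x * e  ≤⟨ +-mono-≤ (≤-reflexive (*-comm x y)) (+-cancelʳ-≤ (d * e) _ _ (begin
      x * e + d * e  ≡⟨ trans (sym (*-distribʳ-+ e x d)) (*-comm (x + d) e) ⟩
      e * (x + d)    ≤⟨ h ⟩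
      d * (y + e)    ≡⟨ trans (*-distribˡ-+ d y e) (cong (_+ d * e) (*-comm d y)) ⟩
      y * d + d * e  ∎)) ⟩
    y * x + y * d  ≡⟨ *-distribˡ-+ y x d ⟨
    y * (x + d)    ∎

  cross⁻ : x * (y + e) ≤ y * (x + d) → e * (x + d) ≤ d * (y + e)
  cross⁻ h = begin
    e * (x + d)    ≡⟨ trans (*-comm e _) (*-distribʳ-+ e x d) ⟩
    x * e + d * e  ≤⟨ +-monoˡ-≤ (d * e) (+-cancelˡ-≤ (x * y) _ _ (begin
      x * y + x * e  ≡⟨ *-distribˡ-+ x y e ⟨
      x * (y + e)    ≤⟨ h ⟩
      y * (x + d)    ≡⟨ trans (*-distribˡ-+ y x d) (cong (_+ y * d) (*-comm y x)) ⟩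
      x * y + y * d  ∎)) ⟩
    y * d + d * e  ≡⟨ trans (*-distribˡ-+ d y e) (cong (_+ d * e) (*-comm d y)) ⟨
    d * (y + e)    ∎

module Profiles {p : ℕ} (ns ks : Fin p → ℕ) (k<n : ∀ i → ks i < ns i) where

  -- With d = n ∸ k, (k ∸ a) / (n ∸ a) = 1 ∸ d / (n ∸ a); comparing the subtracted terms keeps the
  -- ratio condition inside ℕ even when k < a.
  d : Fin p → ℕ
  d i = ns i ∸ ks i

  -- Local optimality: the factor that one more unit would bring at `i` is at most the factor
  -- brought by the last unit at `j`.
  Balanced : (Fin p → ℕ) → Set
  Balanced a = ∀ i j → 1 ≤ a j → d j * (ns i ∸ a i) ≤ d i * (ns j ∸ (a j ∸ 1))

  k≤n : ∀ i → ks i ≤ ns i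
  k≤n i = <⇒≤ (k<n i)

  d>0 : ∀ i → 0 < d i
  d>0 i = m<n⇒0<n∸m (k<n i)

  -- Replacing each numerator by denominator minus `d` makes the product of the two denominators
  -- cancel, so both inequalities say that the same integer is nonnegative. The bounds `a<n` make
  -- truncated subtraction agree with subtraction in ℤ.
  ratioCond⇔ : (T : Subset (total ns)) → (∀ i → blockCount ns T i < ns i) → ∀ i j → 1 ≤ blockCount ns T j →
               RatioCond ns ks T i j ⇔ d j * (ns i ∸ blockCount ns T i) ≤ d i * (ns j ∸ (blockCount ns T j ∸ 1))
  ratioCond⇔ T a<n i j 1≤aj = mk⇔
    (λ r → ℤₚ.drop‿+≤+ (ℤₚ.0≤i-j⇒j≤i (subst (ℤ.0ℤ ℤ.≤_) difference (ℤₚ.i≤j⇒0≤j-i r))))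
    (λ r → ℤₚ.0≤i-j⇒j≤i (subst (ℤ.0ℤ ℤ.≤_) (sym difference) (ℤₚ.i≤j⇒0≤j-i (ℤ.+≤+ r))))
    where
    open ℤ using (+_)
    a = blockCount ns T
    pos-∸ : ∀ {m n} → n ≤ m → + (m ∸ n) ≡ + m ℤ.- + n
    pos-∸ {m} {n} n≤m = trans (sym (ℤₚ.⊖-≥ n≤m)) (sym (ℤₚ.m-n≡m⊖n m n))
    pos-∸∸1 : ∀ {m n} → 1 ≤ n → n ≤ m → + (m ∸ (n ∸ 1)) ≡ + m ℤ.- + n ℤ.+ + 1
    pos-∸∸1 {m} {suc n} _ n<m = trans (pos-∸ (<⇒≤ n<m)) (ring (+ m) (+ n))
      where
      ring : ∀ x y → x ℤ.- y ≡ x ℤ.- (+ 1 ℤ.+ y) ℤ.+ + 1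
      ring = solve-∀-ℤ
    identity : ∀ kᵢ aᵢ nᵢ kⱼ aⱼ nⱼ →
      (kⱼ ℤ.- aⱼ ℤ.+ + 1) ℤ.* (nᵢ ℤ.- aᵢ) ℤ.- (kᵢ ℤ.- aᵢ) ℤ.* (nⱼ ℤ.- aⱼ ℤ.+ + 1)
      ≡ (nᵢ ℤ.- kᵢ) ℤ.* (nⱼ ℤ.- aⱼ ℤ.+ + 1) ℤ.- (nⱼ ℤ.- kⱼ) ℤ.* (nᵢ ℤ.- aᵢ)
    identity = solve-∀-ℤ
    difference :
      (+ ks j ℤ.- + a j ℤ.+ + 1) ℤ.* (+ ns i ℤ.- + a i) ℤ.- (+ ks i ℤ.- + a i) ℤ.* (+ ns j ℤ.- + a j ℤ.+ + 1)
      ≡ + (d i * (ns j ∸ (a j ∸ 1))) ℤ.- + (d j * (ns i ∸ a i))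
    difference = trans (identity (+ ks i) (+ a i) (+ ns i) (+ ks j) (+ a j) (+ ns j)) (sym (cong₂ ℤ._-_
      (trans (ℤₚ.pos-* (d i) _) (cong₂ ℤ._*_ (pos-∸ (k≤n i)) (pos-∸∸1 1≤aj (<⇒≤ (a<n j)))))
      (trans (ℤₚ.pos-* (d j) _) (cong₂ ℤ._*_ (pos-∸ (k≤n j)) (pos-∸ (<⇒≤ (a<n i)))))))

  fraction-trans : {f : Fin p → ℕ} → ∀ {i j k} → f i * d j ≤ f j * d i → f j * d k ≤ f k * d j → f i * d k ≤ f k * d i
  fraction-trans {f} {i} {j} {k} r s = *-cancelʳ-≤ _ _ (d j) {{>-nonZero (d>0 j)}} (begin
    f i * d k * d j  ≡⟨ xy∙z≡xz∙y (f i) (d k) (d j) ⟩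
    f i * d j * d k  ≤⟨ *-monoˡ-≤ (d k) r ⟩
    f j * d i * d k  ≡⟨ xy∙z≡xz∙y (f j) (d i) (d k) ⟩
    f j * d k * d i  ≤⟨ *-monoˡ-≤ (d i) s ⟩
    f k * d j * d i  ≡⟨ xy∙z≡xz∙y (f k) (d j) (d i) ⟩
    f k * d i * d j  ∎)

  ≤-updateAt-suc : ∀ {p} (a : Fin p → ℕ) j i → a i ≤ updateAt a j suc i
  ≤-updateAt-suc a zero    zero    = n≤1+n _
  ≤-updateAt-suc a zero    (suc i) = ≤-refl
  ≤-updateAt-suc a (suc j) zero    = ≤-refl
  ≤-updateAt-suc a (suc j) (suc i) = ≤-updateAt-suc (a ∘ suc) j i

  -- Greedy: raise the coordinate whose next factor (k ∸ a) / (n ∸ a) is largest.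
  ∃-balanced : Fin p → ∀ t → ∃ λ a → total a ≡ t × Balanced a
  ∃-balanced i₀ zero = (λ _ → 0) , total-zero p , λ i j ()
    where
    total-zero : ∀ p → total {p} (λ _ → 0) ≡ 0
    total-zero zero    = refl
    total-zero (suc p) = total-zero p
  ∃-balanced i₀ (suc t) with ∃-balanced i₀ t
  ... | a , total-a , bal
    -- As `(k - a) / (n - a) = 1 - d / (n - a)`, the largest factor belongs to the largest
    -- `(n - a) / d`.
    with ∃-max (λ _ → yes tt) (λ i j → ≤-total ((ns i ∸ a i) * d j) ((ns j ∸ a j) * d i)) (fraction-trans {λ i → ns i ∸ a i}) (i₀ , tt)
  ... | j₀ , _ , j₀-max = updateAt a j₀ suc , trans (total-updateAt-suc a j₀) (cong suc total-a) , bal′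
    where
    bal′ : Balanced (updateAt a j₀ suc)
    -- Raising a coordinate can only lower the left side. On the right, a coordinate other than `j₀`
    -- keeps its last factor, and the last factor at `j₀` is the maximum just chosen.
    bal′ i j 1≤a′j = ≤-trans (*-monoʳ-≤ (d j) (∸-monoʳ-≤ (ns i) (≤-updateAt-suc a j₀ i))) bound
      where
      bound : d j * (ns i ∸ a i) ≤ d i * (ns j ∸ (updateAt a j₀ suc j ∸ 1))
      bound with j Fin.≟ j₀
      ... | yes refl = subst (λ z → d j * (ns i ∸ a i) ≤ d i * (ns j ∸ (z ∸ 1))) (sym (updateAt-updates j₀ a))
                         (subst₂ _≤_ (*-comm _ (d j)) (*-comm _ (d i)) (j₀-max i tt))
      ... | no  j≢j₀ = subst (λ z → d j * (ns i ∸ a i) ≤ d i * (ns j ∸ (z ∸ 1))) (sym same)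
                         (bal i j (subst (1 ≤_) same 1≤a′j))
        where same = updateAt-minimal j j₀ a j≢j₀

  module _ {t : ℕ} (1≤t : 1 ≤ t) (t<n : ∀ i → t < ns i) where

    total<n : (a : Fin p → ℕ) → total a ≡ t → ∀ i → a i < ns i
    total<n a refl i = ≤-<-trans (≤-total-at a i) (t<n i)

    -- Lagrange multiplier: weighting C(n_i ∸ c, k_i ∸ c) by (v / u)^c, where u / v is the smallest
    -- factor used by a, makes a i the maximiser of every coordinate separately.
    balanced⇒max : (a b : Fin p → ℕ) → total a ≡ t → total b ≡ t → Balanced a → prodBinom ns ks b ≤ prodBinom ns ks a
    balanced⇒max a b total-a total-b bal with prodBinom ns ks b in Pb
    -- The other case gives `t ≤ total ks`; without it `u` could be 0, and the weights could not be
    -- cancelled.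
    ... | zero  = z≤n
    ... | suc _ = subst (_≤ prodBinom ns ks a) Pb (*-cancelʳ-≤ _ _ (weight a) {{>-nonZero weight>0}} (begin
        prodBinom ns ks b * weight a  ≡⟨ cong (prodBinom ns ks b *_) weight-eq ⟩
        prodBinom ns ks b * weight b  ≡⟨ prod-* (λ i → P i (b i)) (λ i → w (b i)) ⟨
        prod (λ i → Q i (b i))        ≤⟨ prod-mono (λ i → unimodal-max (Q i) (a i) t (descend i) (ascend i)
                                           (subst (b i ≤_) total-b (≤-total-at b i))) ⟩
        prod (λ i → Q i (a i))        ≡⟨ prod-* (λ i → P i (a i)) (λ i → w (a i)) ⟩
        prodBinom ns ks a * weight a  ∎))
      where
      t≤k : t ≤ total ks
      t≤k = subst (_≤ total ks) total-b (prodBinom>0⇒total≤ ns ks b (subst (1 ≤_) (sym Pb) (s≤s z≤n)))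
      next : Fin p → ℕ
      next i = ns i ∸ (a i ∸ 1)
      -- The last factor used at `i` is `1 - d i / next i`, so the smallest one has the smallest
      -- `next / d`. Only coordinates with a last unit compete, and `1 ≤ t` provides one.
      minimiser = ∃-max (λ i → 1 ≤? a i) (λ i j → ≤-total (next j * d i) (next i * d j))
                    (λ {i} {j} {k} r s → fraction-trans {next} {k} {j} {i} s r)
                    (total>0⇒∃>0 a (subst (1 ≤_) (sym total-a) 1≤t))
      j = proj₁ minimiser
      1≤aj : 1 ≤ a j
      1≤aj = proj₁ (proj₂ minimiser)
      j-min : ∀ i → 1 ≤ a i → next j * d i ≤ next i * d j
      j-min = proj₂ (proj₂ minimiser)
      u v : ℕ
      u = ks j ∸ (a j ∸ 1)
      v = next j
      -- Otherwise the last factor at `j` is not positive; balance then makes every next factor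
      -- nonpositive, so `ks i ≤ a i` everywhere, strictly at `j`, against `t ≤ total ks`.
      aj∸1<kj : a j ∸ 1 < ks j
      aj∸1<kj with a j ∸ 1 <? ks j
      ... | yes lt = lt
      ... | no ¬lt = contradiction (subst (total ks <_) total-a (total-mono-< k≤a j
                       (≤-<-trans (≮⇒≥ ¬lt) (≤-reflexive (m+[n∸m]≡n 1≤aj))))) (≤⇒≯ t≤k)
        where
        k≤a : ∀ i → ks i ≤ a i
        k≤a i = ≮⇒≥ λ a<k → <⇒≱ (∸-monoʳ-< a<k (k≤n i)) (*-cancelˡ-≤ (d j) {{>-nonZero (d>0 j)}} (begin
          d j * (ns i ∸ a i)  ≤⟨ bal i j 1≤aj ⟩
          d i * next j        ≤⟨ *-monoʳ-≤ (d i) (∸-monoʳ-≤ (ns j) (≮⇒≥ ¬lt)) ⟩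
          d i * d j           ≡⟨ *-comm (d i) (d j) ⟩
          d j * d i           ∎))
      u>0 : 0 < u
      u>0 = m<n⇒0<n∸m aj∸1<kj
      v≡u+d : v ≡ u + d j
      v≡u+d = ∸-split (<⇒≤ aj∸1<kj) (k≤n j)
      P : Fin p → ℕ → ℕ
      P i = binomSub (ns i) (ks i)
      -- `(v / u) ^ c` multiplied by `u ^ t` to stay in ℕ. The product over all coordinates depends
      -- only on the sum of the profile.
      w : ℕ → ℕ
      w c = v ^ c * u ^ (t ∸ c)
      Q : Fin p → ℕ → ℕ
      Q i c = P i c * w c
      weight : (Fin p → ℕ) → ℕ
      weight b = prod (λ i → w (b i))
      w>0 : ∀ c → 0 < w c
      w>0 c = *-mono-≤ (m^n>0 v {{>-nonZero (subst (0 <_) (sym v≡u+d) (<-≤-trans u>0 (m≤m+n u _)))}} c) (m^n>0 u {{>-nonZero u>0}} (t ∸ c))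
      weight>0 : 0 < weight a
      weight>0 = prod>0 λ i → w>0 (a i)
        where
        prod>0 : ∀ {p} {f : Fin p → ℕ} → (∀ i → 0 < f i) → 0 < prod f
        prod>0 {zero}  h = s≤s z≤n
        prod>0 {suc p} h = *-mono-≤ (h zero) (prod>0 (h ∘ suc))
      weight-by-total : ∀ b → total b ≡ t → weight b ≡ v ^ t * u ^ (total {p} (λ _ → t) ∸ t)
      weight-by-total b total-b = begin-equality
        weight b                                              ≡⟨ prod-* (λ i → v ^ b i) (λ i → u ^ (t ∸ b i)) ⟩
        prod (λ i → v ^ b i) * prod (λ i → u ^ (t ∸ b i))     ≡⟨ cong₂ _*_ (prod-^ v b) (prod-^ u (λ i → t ∸ b i)) ⟩
        v ^ total b * u ^ total (λ i → t ∸ b i)               ≡⟨ cong₂ (λ y z → v ^ y * u ^ z) total-b complement ⟩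
        v ^ t * u ^ (total {p} (λ _ → t) ∸ t)                 ∎
        where
        complement : total (λ i → t ∸ b i) ≡ total {p} (λ _ → t) ∸ t
        complement = begin-equality
          total (λ i → t ∸ b i)                      ≡⟨ m+n∸n≡m _ (total b) ⟨
          total (λ i → t ∸ b i) + total b ∸ total b  ≡⟨ cong₂ _∸_ (trans (sym (total-+ (λ i → t ∸ b i) b))
              (total-cong λ i → m∸n+n≡m (subst (b i ≤_) total-b (≤-total-at b i)))) total-b ⟩
          total {p} (λ _ → t) ∸ t                    ∎
      weight-eq : weight a ≡ weight b
      weight-eq = trans (weight-by-total a total-a) (sym (weight-by-total b total-b))
      step-⇑ : ∀ c x → x * (v ^ suc c * u ^ (t ∸ suc c)) ≡ x * v * (v ^ c * u ^ (t ∸ suc c))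
      step-⇑ c x = lemma x v (v ^ c) _
        where
        lemma : ∀ x v y z → x * (v * y * z) ≡ x * v * (y * z)
        lemma = solve-∀
      step-⇓ : ∀ c x → c < t → x * (v ^ c * u ^ (t ∸ c)) ≡ x * u * (v ^ c * u ^ (t ∸ suc c))
      step-⇓ c x c<t = trans (cong (λ e → x * (v ^ c * u ^ e)) (+-∸-assoc 1 c<t)) (lemma x u (v ^ c) _)
        where
        lemma : ∀ x u y z → x * (y * (u * z)) ≡ x * u * (y * z)
        lemma = solve-∀
      -- Balance against `j` bounds the factor at `a i` by `u / v`, and later factors are smaller
      -- still.
      descend : ∀ i c → a i ≤ c → c < t → Q i (suc c) ≤ Q i c
      descend i c a≤c c<t = begin
        P i (suc c) * w (suc c)                          ≡⟨ step-⇑ c (P i (suc c)) ⟩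
        P i (suc c) * v * (v ^ c * u ^ (t ∸ suc c))      ≤⟨ *-monoˡ-≤ (v ^ c * u ^ (t ∸ suc c)) factor ⟩
        P i c * u * (v ^ c * u ^ (t ∸ suc c))            ≡⟨ step-⇓ c (P i c) c<t ⟨
        P i c * w c                                      ∎
        where
        c<n = <-trans c<t (t<n i)
        ratio : (ks i ∸ c) * v ≤ u * (ns i ∸ c)
        ratio with c ≤? ks i
        ... | no  c≰k = subst (λ z → z * v ≤ u * (ns i ∸ c)) (sym (m≤n⇒m∸n≡0 (<⇒≤ (≰⇒> c≰k)))) z≤n
        ... | yes c≤k = subst₂ (λ y z → (ks i ∸ c) * y ≤ u * z) (sym v≡u+d) (sym (∸-split c≤k (k≤n i)))
          (cross⁺ (ks i ∸ c) u (d i) (d j) (subst₂ (λ y z → d j * y ≤ d i * z) (∸-split c≤k (k≤n i)) v≡u+d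
            (≤-trans (*-monoʳ-≤ (d j) (∸-monoʳ-≤ (ns i) a≤c)) (bal i j 1≤aj))))
        factor : P i (suc c) * v ≤ P i c * u
        factor = *-cancelʳ-≤ _ _ (ns i ∸ c) {{>-nonZero (m<n⇒0<n∸m c<n)}} (begin
          P i (suc c) * v * (ns i ∸ c)   ≡⟨ xy∙z≡xz∙y (P i (suc c)) v _ ⟩
          P i (suc c) * (ns i ∸ c) * v   ≡⟨ cong (_* v) (binomSub-suc (ns i) (ks i) c<n) ⟩
          P i c * (ks i ∸ c) * v         ≡⟨ *-assoc (P i c) _ v ⟩
          P i c * ((ks i ∸ c) * v)       ≤⟨ *-monoʳ-≤ (P i c) ratio ⟩
          P i c * (u * (ns i ∸ c))       ≡⟨ *-assoc (P i c) u _ ⟨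
          P i c * u * (ns i ∸ c)         ∎)
      -- The factors below `a i` are at least the last one used there, which is at least `u / v` by
      -- the choice of `j`.
      ascend : ∀ i c → c < a i → Q i c ≤ Q i (suc c)
      ascend i c c<a = begin
        P i c * w c                                      ≡⟨ step-⇓ c (P i c) c<t ⟩
        P i c * u * (v ^ c * u ^ (t ∸ suc c))            ≤⟨ *-monoˡ-≤ (v ^ c * u ^ (t ∸ suc c)) factor ⟩
        P i (suc c) * v * (v ^ c * u ^ (t ∸ suc c))      ≡⟨ step-⇑ c (P i (suc c)) ⟨
        P i (suc c) * w (suc c)                          ∎
        where
        c<t : c < t
        c<t = <-≤-trans c<a (subst (a i ≤_) total-a (≤-total-at a i))
        c<n = <-trans c<t (t<n i)
        steps : d i * v ≤ d j * (ns i ∸ c)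
        steps = begin
          d i * v                    ≡⟨ *-comm (d i) v ⟩
          next j * d i               ≤⟨ j-min i (≤-trans (s≤s z≤n) c<a) ⟩
          next i * d j               ≡⟨ *-comm (next i) (d j) ⟩
          d j * (ns i ∸ (a i ∸ 1))   ≤⟨ *-monoʳ-≤ (d j) (∸-monoʳ-≤ (ns i) (pred-mono-≤ c<a)) ⟩
          d j * (ns i ∸ c)           ∎
        ratio : u * (ns i ∸ c) ≤ (ks i ∸ c) * v
        ratio with c ≤? ks i
        ... | yes c≤k = subst₂ (λ y z → u * z ≤ (ks i ∸ c) * y) (sym v≡u+d) (sym (∸-split c≤k (k≤n i)))
          (cross⁺ u (ks i ∸ c) (d j) (d i) (subst₂ (λ y z → d i * z ≤ d j * y) (∸-split c≤k (k≤n i)) v≡u+d steps))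
        -- A factor past `ks i` would be negative, yet it is at least `u / v > 0`.
        ... | no c≰k = contradiction (*-cancelˡ-≤ (d i) {{>-nonZero (d>0 i)}} (begin
            d i * (u + d j)     ≡⟨ cong (d i *_) v≡u+d ⟨
            d i * v             ≤⟨ steps ⟩
            d j * (ns i ∸ c)    ≤⟨ *-monoʳ-≤ (d j) (∸-monoʳ-≤ (ns i) (<⇒≤ (≰⇒> c≰k))) ⟩
            d j * d i           ≡⟨ *-comm (d j) (d i) ⟩
            d i * d j           ∎)) (<⇒≱ (m<n+m (d j) u>0))
        factor : P i c * u ≤ P i (suc c) * v
        factor = *-cancelʳ-≤ _ _ (ns i ∸ c) {{>-nonZero (m<n⇒0<n∸m c<n)}} (begin
          P i c * u * (ns i ∸ c)         ≡⟨ *-assoc (P i c) u _ ⟩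
          P i c * (u * (ns i ∸ c))       ≤⟨ *-monoʳ-≤ (P i c) ratio ⟩
          P i c * ((ks i ∸ c) * v)       ≡⟨ *-assoc (P i c) _ v ⟨
          P i c * (ks i ∸ c) * v         ≡⟨ cong (_* v) (binomSub-suc (ns i) (ks i) c<n) ⟨
          P i (suc c) * (ns i ∸ c) * v   ≡⟨ xy∙z≡xz∙y (P i (suc c)) _ v ⟩
          P i (suc c) * v * (ns i ∸ c)   ∎)

    -- Exchange argument: `c` takes one unit away from `j`, and `b` gives it to `i`. Both products
    -- are `Pc` times a single factor, so `Pb ≤ Pa` compares these factors. Positivity of the
    -- product keeps `c` below `ks`, where complements can be taken.
    max⇒balanced : (a : Fin p → ℕ) → total a ≡ t → 1 ≤ prodBinom ns ks a →
                   (∀ b → total b ≡ t → prodBinom ns ks b ≤ prodBinom ns ks a) → Balanced a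
    max⇒balanced a total-a Pa>0 a-max i j 1≤aj with i Fin.≟ j
    ... | yes refl = *-monoʳ-≤ (d i) (∸-monoʳ-≤ (ns i) (m∸n≤m (a i) 1))
    ... | no  i≢j  = subst₂ (λ x y → d j * (ns i ∸ x) ≤ d i * (ns j ∸ y)) ci≡ai cj≡aj∸1
        (subst₂ (λ x y → d j * x ≤ d i * y) (sym (∸-split (c≤k i) (k≤n i))) (sym (∸-split (c≤k j) (k≤n j)))
          (cross⁻ (ks i ∸ c i) (ks j ∸ c j) (d i) (d j) (subst₂ (λ x y → (ks i ∸ c i) * y ≤ (ks j ∸ c j) * x) (∸-split (c≤k i) (k≤n i)) (∸-split (c≤k j) (k≤n j)) exchange)))
      where
      c : Fin p → ℕ
      c = updateAt a j pred
      ci≡ai : c i ≡ a i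
      ci≡ai = updateAt-minimal i j a i≢j
      cj≡aj∸1 : c j ≡ a j ∸ 1
      cj≡aj∸1 = trans (updateAt-updates j a) (pred≡∸1 (a j))
        where
        pred≡∸1 : ∀ n → pred n ≡ n ∸ 1
        pred≡∸1 zero    = refl
        pred≡∸1 (suc n) = refl
      restore : ∀ l → updateAt c j suc l ≡ a l
      restore l with l Fin.≟ j
      ... | yes refl = trans (updateAt-updates l c) (trans (cong suc cj≡aj∸1) (m+[n∸m]≡n 1≤aj))
      ... | no  l≢j  = trans (updateAt-minimal l j c l≢j) (updateAt-minimal l j a l≢j)
      c≤a : ∀ l → c l ≤ a l
      c≤a l = subst (c l ≤_) (restore l) (≤-updateAt-suc c j l)
      c≤k : ∀ l → c l ≤ ks l
      c≤k l = ≤-trans (c≤a l) (binomSub>0⇒≤ (ns l) (ks l) (a l) (prod>0⇒>0 (λ i → binomSub (ns i) (ks i) (a i)) Pa>0 l))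
      c<n : ∀ l → c l < ns l
      c<n l = ≤-<-trans (c≤k l) (k<n l)
      b : Fin p → ℕ
      b = updateAt c i suc
      Pa Pb Pc : ℕ
      Pa = prodBinom ns ks a
      Pb = prodBinom ns ks b
      Pc = prodBinom ns ks c
      Pb≤Pa : Pb ≤ Pa
      Pb≤Pa = a-max b (trans (total-updateAt-suc c i) (trans (sym (total-updateAt-suc c j)) (trans (total-cong restore) total-a)))
      Pa-step : Pa * (ns j ∸ c j) ≡ Pc * (ks j ∸ c j)
      Pa-step = trans (cong (_* (ns j ∸ c j)) (prod-cong λ l → cong (binomSub (ns l) (ks l)) (sym (restore l)))) (prodBinom-suc ns ks c j (c<n j))
      Pc>0 : 0 < Pc
      Pc>0 with Pc in eq
      ... | suc _ = s≤s z≤n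
      ... | zero  = contradiction (trans (sym (cong (_* (ks j ∸ c j)) eq)) (sym Pa-step))
                      (<⇒≢ (*-mono-≤ Pa>0 (m<n⇒0<n∸m (c<n j))))
      exchange : (ks i ∸ c i) * (ns j ∸ c j) ≤ (ks j ∸ c j) * (ns i ∸ c i)
      exchange = *-cancelˡ-≤ Pc {{>-nonZero Pc>0}} (begin
        Pc * ((ks i ∸ c i) * (ns j ∸ c j))  ≡⟨ *-assoc Pc _ _ ⟨
        Pc * (ks i ∸ c i) * (ns j ∸ c j)    ≡⟨ cong (_* (ns j ∸ c j)) (prodBinom-suc ns ks c i (c<n i)) ⟨
        Pb * (ns i ∸ c i) * (ns j ∸ c j)    ≤⟨ *-monoˡ-≤ (ns j ∸ c j) (*-monoˡ-≤ (ns i ∸ c i) Pb≤Pa) ⟩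
        Pa * (ns i ∸ c i) * (ns j ∸ c j)    ≡⟨ xy∙z≡xz∙y Pa _ _ ⟩
        Pa * (ns j ∸ c j) * (ns i ∸ c i)    ≡⟨ cong (_* (ns i ∸ c i)) Pa-step ⟩
        Pc * (ks j ∸ c j) * (ns i ∸ c i)    ≡⟨ *-assoc Pc _ _ ⟩
        Pc * ((ks j ∸ c j) * (ns i ∸ c i))  ∎)

-- The bound and the families that attain it

theorem1p2 : (p t : ℕ) → 1 ≤ p → 1 ≤ t →
    (ns ks : Fin p → ℕ) →
    (∀ i → 1 ≤ ns i) → (∀ i → 1 ≤ ks i) → (∀ i → ks i ≤ ns i) →
    (𝓕 : List (Subset (total ns))) → Unique 𝓕 →
    (∀ {A} → A ∈ 𝓕 → InH1 ns ks A) →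
    TIntersecting t 𝓕 →
    (∀ i → 2 * (t + 1) * p * ks i ^ 2 < ns i) →
    (m : ℕ) → IsMaxProd ns ks t m →
    (length 𝓕 ≤ m)
    × (length 𝓕 ≡ m ⇔
    ∃ λ (T : Subset (total ns)) → ∣ T ∣ ≡ t
    × (∀ i j → 1 ≤ blockCount ns T j → RatioCond ns ks T i j)
    × (∀ A → A ∈ 𝓕 ⇔ (InH1 ns ks A × T ⊆ A)))
theorem1p2 p t 1≤p 1≤t ns ks _ 1≤k k≤n 𝓕 u 𝓕⊆H 𝓕-int large m ((ts , total-ts , prod-ts) , m-max) =
  bound , mk⇔ extremal⇒star star⇒extremal
  where
  open Branching 1≤p ns ks 1≤k k≤n 𝓕 (proj₂ ∘ 𝓕⊆H) 𝓕-int large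
  open Profiles ns ks k<n using (Balanced; ratioCond⇔; ∃-balanced; total<n; balanced⇒max; max⇒balanced)

  profile-total : ∀ T → ∣ T ∣ ≡ t → total (blockCount ns T) ≡ t
  profile-total T ∣T∣≡t = trans (total-blockCount ns T) ∣T∣≡t

  N≤m : ∀ T → ∣ T ∣ ≡ t → N T ≤ m
  N≤m T ∣T∣≡t = m-max (blockCount ns T) (profile-total T ∣T∣≡t)

  ratio⇔ : ∀ T → ∣ T ∣ ≡ t → ∀ i j → 1 ≤ blockCount ns T j → _
  ratio⇔ T ∣T∣≡t = ratioCond⇔ T (total<n 1≤t t<n (blockCount ns T) (profile-total T ∣T∣≡t))

  balanced⇒ratio : ∀ T → ∣ T ∣ ≡ t → Balanced (blockCount ns T) → ∀ i j → 1 ≤ blockCount ns T j → RatioCond ns ks T i j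
  balanced⇒ratio T ∣T∣≡t bal i j 1≤aj = Equivalence.from (ratio⇔ T ∣T∣≡t i j 1≤aj) (bal i j 1≤aj)

  bound : length 𝓕 ≤ m
  bound with empty⊎star⊎small u N≤m
  ... | inj₁ 𝓕≡[]                       = subst (λ 𝓖 → length 𝓖 ≤ m) (sym 𝓕≡[]) z≤n
  ... | inj₂ (inj₁ (Y , ∣Y∣≡t , Y⊆ , _)) = ≤-trans (star-bound Y u λ A∈ → A∈ , Y⊆ A∈) (N≤m Y ∣Y∣≡t)
  ... | inj₂ (inj₂ 𝓕<m)                  = <⇒≤ 𝓕<m

  extremal⇒star : length 𝓕 ≡ m → ∃ λ T → ∣ T ∣ ≡ t × (∀ i j → 1 ≤ blockCount ns T j → RatioCond ns ks T i j)
                                   × (∀ A → A ∈ 𝓕 ⇔ (InH1 ns ks A × T ⊆ A))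
  extremal⇒star 𝓕≡m with empty⊎star⊎small u N≤m
  extremal⇒star 𝓕≡m | inj₂ (inj₂ 𝓕<m) = contradiction 𝓕≡m (<⇒≢ 𝓕<m)
  extremal⇒star 𝓕≡m | inj₂ (inj₁ (Y , ∣Y∣≡t , Y⊆ , _ , A₀∈)) =
      Y , ∣Y∣≡t , balanced⇒ratio Y ∣Y∣≡t bal , λ A → mk⇔ 𝓕⇒star (star⇒𝓕 A)
    where
    𝓕⇒star : ∀ {A} → A ∈ 𝓕 → InH1 ns ks A × Y ⊆ A
    𝓕⇒star A∈ = 𝓕⊆H A∈ , Y⊆ A∈
    star⇒𝓕 : ∀ A → InH1 ns ks A × Y ⊆ A → A ∈ 𝓕
    -- The star of `Y` contains `𝓕` and has at most `m = length 𝓕` members, so nothing is missing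
    -- from `𝓕`.
    star⇒𝓕 A (A∈H , Y⊆A) = unique-⊆∧length≥⇒⊇ (≡-dec Bool._≟_) u
      (λ A∈ → ∈-star⁺ ns ks Y _ (proj₂ (𝓕⊆H A∈)) (Y⊆ A∈))
      (subst (_≤ length 𝓕) (sym (length-star ns ks Y)) (≤-trans (N≤m Y ∣Y∣≡t) (≤-reflexive (sym 𝓕≡m))))
      (∈-star⁺ ns ks Y A (proj₂ A∈H) Y⊆A)
    -- The chain `m = length 𝓕 ≤ N Y ≤ m` shows that the profile of `Y` attains the maximum.
    NY≡m : N Y ≡ m
    NY≡m = ≤-antisym (N≤m Y ∣Y∣≡t) (subst (_≤ N Y) 𝓕≡m (star-bound Y u λ A∈ → A∈ , Y⊆ A∈))
    bal : Balanced (blockCount ns Y)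
    bal = max⇒balanced 1≤t t<n (blockCount ns Y) (profile-total Y ∣Y∣≡t)
      (subst (1 ≤_) (trans 𝓕≡m (sym NY≡m)) (∈⇒length>0 A₀∈))
      λ b total-b → subst (prodBinom ns ks b ≤_) (sym NY≡m) (m-max b total-b)
  -- Here `m = 0`, so the star of every `t`-set is empty and agrees with `𝓕`; only the ratio
  -- condition restricts `T`, and the greedy profile satisfies it.
  extremal⇒star 𝓕≡m | inj₁ 𝓕≡[] with ∃-balanced (Fin.fromℕ< 1≤p) t
  extremal⇒star 𝓕≡m | inj₁ 𝓕≡[] | a , total-a , bal with ∃-blockCount ns a (λ i → <⇒≤ (total<n 1≤t t<n a total-a i))
  extremal⇒star 𝓕≡m | inj₁ 𝓕≡[] | a , total-a , bal | T , T≗a = T , ∣T∣≡t , balanced⇒ratio T ∣T∣≡t bal′ , λ A →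
      mk⇔ (λ A∈ → contradiction A∈ (∉𝓕 𝓕≡[])) (λ A∈ → contradiction A∈ (∉star A))
    where
    ∣T∣≡t : ∣ T ∣ ≡ t
    ∣T∣≡t = trans (sym (total-blockCount ns T)) (trans (total-cong T≗a) total-a)
    bal′ : Balanced (blockCount ns T)
    bal′ i j 1≤aj rewrite T≗a i | T≗a j = bal i j 1≤aj
    m≡0 : m ≡ 0
    m≡0 = trans (sym 𝓕≡m) (cong length 𝓕≡[])
    ∉𝓕 : ∀ {A} → 𝓕 ≡ [] → ¬ A ∈ 𝓕
    ∉𝓕 refl ()
    ∉star : ∀ A → ¬ (InH1 ns ks A × T ⊆ A)
    ∉star A (A∈H , T⊆A) = <⇒≱ (∈⇒length>0 (∈-star⁺ ns ks T A (proj₂ A∈H) T⊆A))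
      (subst₂ _≤_ (sym (length-star ns ks T)) m≡0 (N≤m T ∣T∣≡t))

  star⇒extremal : (∃ λ T → ∣ T ∣ ≡ t × (∀ i j → 1 ≤ blockCount ns T j → RatioCond ns ks T i j)
                             × (∀ A → A ∈ 𝓕 ⇔ (InH1 ns ks A × T ⊆ A))) → length 𝓕 ≡ m
  star⇒extremal (T , ∣T∣≡t , ratio , 𝓕⇔) = ≤-antisym bound (begin
    m                     ≡⟨ prod-ts ⟨
    prodBinom ns ks ts    ≤⟨ balanced⇒max 1≤t t<n (blockCount ns T) ts (profile-total T ∣T∣≡t) total-ts
                               (λ i j 1≤aj → Equivalence.to (ratio⇔ T ∣T∣≡t i j 1≤aj) (ratio i j 1≤aj)) ⟩
    N T                   ≡⟨ length-star ns ks T ⟨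
    length (star ns ks T) ≤⟨ unique-⊆⇒length≤ (star-unique ns ks T) star⊆𝓕 ⟩
    length 𝓕              ∎)
    where
    star⊆𝓕 : ∀ {A} → A ∈ star ns ks T → A ∈ 𝓕
    star⊆𝓕 {A} A∈ = let A≡k , T⊆A = ∈-star⁻ ns ks T A∈ in
      Equivalence.from (𝓕⇔ A) ((trans (sym (total-blockCount ns A)) (total-cong A≡k) , A≡k) , T⊆A)
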